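{- Let $\psi:\mathcal C_2\to\mathcal P$ be defined by $\psi(C(p,q))=(\sqrt{q^2-p^2},p,q)$ if $2\mid p$ and $\psi(C(p,q))=(p,\sqrt{q^2-p^2},q)$ if $2\nmid p$. Then $\psi$ is a bijection; the map $\varphi:\mathcal P\to H'$, $\varphi(x,y,z)=$ the element $M\in H'$ with $M(1,0,1)^t=(x,y,z)^t$, is a well-defined bijection; and the binary operation on $\mathcal C_2$ $$C(p_1,q_1)*C(p_2,q_2)=\psi^{ -1}\big(\varphi\psi(C(p_1,q_1))\,\varphi\psi(C(p_2,q_2))\,(1,0,1)^t\big)$$ makes $\mathcal C_2$ a free, non-commutative, infinitely generated monoid with identity $C(1,1)$ (the class of orthogonal well-rounded lattices), and $\varphi\psi:(\mathcal C_2,*)\to H'$ is a monoid isomorphism. Its Cayley digraph with respect to a free generating set is a regular rooted infinite tree in which every vertex has infinite degree.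
   Context: All lattices are full-rank lattices in $\mathbb R^2$. For a lattice $\Lambda$, $|\Lambda|=\min_{x\in\Lambda\setminus\{0\}}\|x\|$ (Euclidean norm) and $S(\Lambda)=\{x\in\Lambda:\|x\|=|\Lambda|\}$; $\Lambda$ is well-rounded (WR) if $S(\Lambda)$ spans $\mathbb R^2$. $\mathrm{WR}(\mathbb Z^2)$ is the set of full-rank WR sublattices of $\mathbb Z^2$. For a WR lattice $\Lambda$, $\theta(\Lambda)\in[\pi/3,\pi/2]$ is the angle between two linearly independent minimal vectors chosen so that the angle is at most $\pi/2$; equivalently $\sin\theta(\Lambda)=\det(\Lambda)/|\Lambda|^2$. For $q\in\mathbb Z_{>0}$ let $\mathcal S_q=\{p/q\in\mathbb Q\cap(\sqrt3/2,1):\gcd(p,q)=1,\ \sqrt{q^2-p^2}\in\mathbb Z\}$ and $\mathcal S=\bigcup_{q}\mathcal S_q\cup\{1\}$, where $1$ is written as $p/q$ with $p=q=1$; elements of $\mathcal S$ are written in lowest terms. For $p/q\in\mathcal S$, $C(p,q)=\{\Lambda\in\mathrm{WR}(\mathbb Z^2):\sin\theta(\Lambda)=p/q\}$, and $\mathcal C_2=\{C(p,q):p/q\in\mathcal S\}$ (these are exactly the similarity classes of lattices in $\mathrm{WR}(\mathbb Z^2)$). Let $\mathfrak P=\{(x,y,z)\in\mathbb Z_{>0}^3: 2\mid y,\ \gcd(x,y,z)=1,\ x^2+y^2=z^2\}$ and $\mathcal P=\{(x,y,z)\in\mathfrak P:\min\{x,y\}<z/2\}\cup\{(1,0,1)\}$.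 Let $A=\begin{pmatrix}1&-2&2\\2&-1&2\\2&-2&3\end{pmatrix}$, $B=\begin{pmatrix}1&2&2\\2&1&2\\2&2&3\end{pmatrix}$, $C=\begin{pmatrix}-1&2&2\\-2&1&2\\-2&2&3\end{pmatrix}$, and let $G$ be the monoid of $3\times3$ matrices generated by $I_3,A,B,C$ under multiplication, acting on triples viewed as column vectors. Let $H$ be the set of all matrices of the forms $A^2NB$, $A^kB$, $ABNB$, $C^2NB$, $C^kB$, $CBNB$, $(AC)^kA^2NB$, $(AC)^kABNB$, $(AC)^kAB$, $(CA)^kC^2NB$, $(CA)^kCBNB$, $(CA)^kCB$, with $N\in G$ and $k\in\mathbb Z_{>0}$, and $H'=H\cup\{I_3\}$ (a submonoid of $G$). -}

module Defs where

open import Level using (Level; _⊔_; 0ℓ) renaming (suc to lsuc)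
open import Algebra.Bundles using (Monoid; RawMonoid)
open import Algebra.Core using (Op₂)
open import Algebra.Structures using (IsMonoid)
open import Data.Integer.Base using (ℤ; +_; -_; 0ℤ; 1ℤ; _+_; _-_; _*_; _≤_; _<_; _⊓_; ∣_∣)
open import Data.Integer.Divisibility using (_∣_)
open import Data.Integer.GCD using (gcd)
open import Data.List.Base using (List; []; _∷_; foldr)
open import Data.List.Relation.Unary.All using (All)
open import Data.List.Relation.Unary.Any using (Any)
open import Data.List.Relation.Binary.Pointwise using (Pointwise)
open import Data.Nat.Base as ℕ using (ℕ; zero; suc)
import Data.Nat.GCD as ℕ
open import Data.Product using (Σ; Σ-syntax; ∃; ∃-syntax; _×_; _,_; proj₁; proj₂)
open import Data.Sum.Base using (_⊎_; inj₁; inj₂)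
open import Data.Vec.Base as Vec using (Vec; []; _∷_)
open import Function.Bundles using (Bijection; Injection)
open import Relation.Binary.Bundles using (Setoid)
open import Relation.Binary.Core using (Rel)
import Relation.Binary.Construct.On as On
open import Relation.Binary.PropositionalEquality using (_≡_; _≢_; refl; setoid)
open import Relation.Unary using (Pred; _∈_; _≐_)
open import Relation.Binary.Definitions using (_Respects_)

private
  variable
    a ℓ ℓ′ : Level

subsetoid : (S : Setoid a ℓ) → Pred (Setoid.Carrier S) ℓ′ → Setoid (a ⊔ ℓ′) ℓ
subsetoid S P = On.setoid {B = ∃ P} S proj₁

ℤ² : Set
ℤ² = ℤ × ℤ

𝟎 : ℤ²
𝟎 = 0ℤ , 0ℤ

infixl 6 _⊕_
infixr 7 _•_

_⊕_ : ℤ² → ℤ² → ℤ²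
(x₁ , x₂) ⊕ (y₁ , y₂) = x₁ + y₁ , x₂ + y₂

_•_ : ℤ → ℤ² → ℤ²
m • (x₁ , x₂) = m * x₁ , m * x₂

⟨_,_⟩ : ℤ² → ℤ² → ℤ
⟨ (x₁ , x₂) , (y₁ , y₂) ⟩ = x₁ * y₁ + x₂ * y₂

‖_‖² : ℤ² → ℤ
‖ x ‖² = ⟨ x , x ⟩

_∧_ : ℤ² → ℤ² → ℤ
(x₁ , x₂) ∧ (y₁ , y₂) = x₁ * y₂ - x₂ * y₁

-- For integer vectors, independence over ℤ, ℚ and ℝ coincide.
LinearlyIndependent : ℤ² → ℤ² → Set
LinearlyIndependent x y = ∀ m n → m • x ⊕ n • y ≡ 𝟎 → m ≡ 0ℤ × n ≡ 0ℤ

data Spanℤ (T : Pred ℤ² 0ℓ) : Pred ℤ² 0ℓ where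
  empty : Spanℤ T 𝟎
  add   : ∀ m {x y} → T x → Spanℤ T y → Spanℤ T (m • x ⊕ y)

-- T spans ℝ² iff it spans ℚ² over ℚ; denominators are cleared.
Spans : Pred ℤ² 0ℓ → Set
Spans T = ∀ w → ∃[ n ] n ≢ 0ℤ × Spanℤ T (n • w)

record Sublattice : Set where
  field
    b₁ b₂       : ℤ²
    independent : LinearlyIndependent b₁ b₂

⟦_⟧ : Sublattice → Pred ℤ² 0ℓ
⟦ Λ ⟧ x = ∃[ m ] ∃[ n ] x ≡ m • b₁ ⊕ n • b₂
  where open Sublattice Λ

-- S(Λ)
Minimal : Sublattice → Pred ℤ² 0ℓ
Minimal Λ x = x ∈ ⟦ Λ ⟧ × x ≢ 𝟎 × (∀ y → y ∈ ⟦ Λ ⟧ → y ≢ 𝟎 → ‖ x ‖² ≤ ‖ y ‖²)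

WR : Pred Sublattice 0ℓ
WR Λ = Spans (Minimal Λ)

-- sin θ(Λ) = p / q.  The angle between x and y is at most π/2 iff
-- 0 ≤ ⟨ x , y ⟩, and its sine is ∣ x ∧ y ∣ / (‖x‖ ‖y‖), where ‖x‖ ‖y‖ = ‖x‖²
-- because both vectors are minimal.
Sinθ≡_/_ : ℕ → ℕ → Pred Sublattice 0ℓ
(Sinθ≡ p / q) Λ = ∃[ x ] ∃[ y ] x ∈ Minimal Λ × y ∈ Minimal Λ × LinearlyIndependent x y
  × 0ℤ ≤ ⟨ x , y ⟩ × + q * + ∣ x ∧ y ∣ ≡ + p * ‖ x ‖²

Orthogonal : Pred Sublattice 0ℓ
Orthogonal Λ = ∃[ x ] ∃[ y ] x ∈ ⟦ Λ ⟧ × y ∈ ⟦ Λ ⟧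
  × (∀ w → w ∈ ⟦ Λ ⟧ → ∃[ m ] ∃[ n ] w ≡ m • x ⊕ n • y)
  × ⟨ x , y ⟩ ≡ 0ℤ

-- r = √(q² − p²)
Leg : (p q r : ℕ) → Set
Leg p q r = r ℕ.* r ℕ.+ p ℕ.* p ≡ q ℕ.* q

-- p / q > √3 / 2 is squared to 3 q² < 4 p².
𝒮[_] : ℕ → Pred ℕ 0ℓ
𝒮[ q ] p = 3 ℕ.* (q ℕ.* q) ℕ.< 4 ℕ.* (p ℕ.* p) × p ℕ.< q × ℕ.gcd p q ≡ 1 × ∃ (Leg p q)

𝒮 : ℕ → ℕ → Set
𝒮 p q = 𝒮[ q ] p ⊎ (p ≡ 1 × q ≡ 1)

C⟨_,_⟩ : ℕ → ℕ → Pred Sublattice 0ℓ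
C⟨ p , q ⟩ Λ = WR Λ × (Sinθ≡ p / q) Λ

-- Sets of sublattices of the form C(p,q) with p / q ∈ 𝒮, compared by extensional
-- equality; a map on 𝒞₂ given in terms of p and q is thus well defined only if
-- it respects that equality.
record 𝒞₂ : Set₁ where
  field
    members : Pred Sublattice 0ℓ
    p q     : ℕ
    p/q∈𝒮   : 𝒮 p q
    isC     : members ≐ C⟨ p , q ⟩

𝒞₂-setoid : Setoid (lsuc 0ℓ) 0ℓ
𝒞₂-setoid = record
  { Carrier       = 𝒞₂
  ; _≈_           = λ c d → members c ≐ members d
  ; isEquivalence = record
    { refl  = (λ x → x) , (λ x → x)
    ; sym   = λ (f , g) → g , f
    ; trans = λ (f , g) (h , k) → (λ x → h (f x)) , (λ x → g (k x))
    }
  }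
  where open 𝒞₂

C : ∀ p q → 𝒮 p q → 𝒞₂
C p q s = record
  { members = C⟨ p , q ⟩
  ; p       = p
  ; q       = q
  ; p/q∈𝒮   = s
  ; isC     = (λ x → x) , (λ x → x)
  }

C₁₁ : 𝒞₂
C₁₁ = C 1 1 (inj₂ (refl , refl))

Triple : Set
Triple = Vec ℤ 3

e : Triple
e = 1ℤ ∷ 0ℤ ∷ 1ℤ ∷ []

𝔓 : Pred Triple 0ℓ
𝔓 (x ∷ y ∷ z ∷ []) = 0ℤ < x × 0ℤ < y × 0ℤ < z × + 2 ∣ y × gcd (gcd x y) z ≡ 1ℤ
  × x * x + y * y ≡ z * z

MinBelowHalf : Pred Triple 0ℓ
MinBelowHalf (x ∷ y ∷ z ∷ []) = + 2 * (x ⊓ y) < z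

𝒫 : Pred Triple 0ℓ
𝒫 t = (t ∈ 𝔓 × MinBelowHalf t) ⊎ t ≡ e

𝒫-setoid : Setoid 0ℓ 0ℓ
𝒫-setoid = subsetoid (setoid Triple) 𝒫

Mat : Set
Mat = Vec (Vec ℤ 3) 3

dot : ∀ {n} → Vec ℤ n → Vec ℤ n → ℤ
dot x y = Vec.foldr′ _+_ 0ℤ (Vec.zipWith _*_ x y)

infixl 7 _·_
infixr 7 _*ᵥ_
infixr 8 _^_

_*ᵥ_ : Mat → Triple → Triple
M *ᵥ v = Vec.map (λ row → dot row v) M

_·_ : Mat → Mat → Mat
M · N = Vec.map (λ row → Vec.map (dot row) (Vec.transpose N)) M

I₃ mA mB mC : Mat
I₃ = (1ℤ ∷ 0ℤ ∷ 0ℤ ∷ []) ∷ (0ℤ ∷ 1ℤ ∷ 0ℤ ∷ []) ∷ (0ℤ ∷ 0ℤ ∷ 1ℤ ∷ []) ∷ []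
mA = (+ 1 ∷ - + 2 ∷ + 2 ∷ []) ∷ (+ 2 ∷ - + 1 ∷ + 2 ∷ []) ∷ (+ 2 ∷ - + 2 ∷ + 3 ∷ []) ∷ []
mB = (+ 1 ∷ + 2 ∷ + 2 ∷ []) ∷ (+ 2 ∷ + 1 ∷ + 2 ∷ []) ∷ (+ 2 ∷ + 2 ∷ + 3 ∷ []) ∷ []
mC = (- + 1 ∷ + 2 ∷ + 2 ∷ []) ∷ (- + 2 ∷ + 1 ∷ + 2 ∷ []) ∷ (- + 2 ∷ + 2 ∷ + 3 ∷ []) ∷ []

_^_ : Mat → ℕ → Mat
M ^ zero  = I₃
M ^ suc k = M · M ^ k

data G : Pred Mat 0ℓ where
  I∈G : G I₃
  A∈G : G mA
  B∈G : G mB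
  C∈G : G mC
  ·∈G : ∀ {M N} → G M → G N → G (M · N)

data H : Pred Mat 0ℓ where
  A²NB      : ∀ {N} → G N → H (mA ^ 2 · N · mB)
  AᵏB       : ∀ k → 0 ℕ.< k → H (mA ^ k · mB)
  ABNB      : ∀ {N} → G N → H (mA · mB · N · mB)
  C²NB      : ∀ {N} → G N → H (mC ^ 2 · N · mB)
  CᵏB       : ∀ k → 0 ℕ.< k → H (mC ^ k · mB)
  CBNB      : ∀ {N} → G N → H (mC · mB · N · mB)
  [AC]ᵏA²NB : ∀ k {N} → 0 ℕ.< k → G N → H ((mA · mC) ^ k · mA ^ 2 · N · mB)
  [AC]ᵏABNB : ∀ k {N} → 0 ℕ.< k → G N → H ((mA · mC) ^ k · mA · mB · N · mB)
  [AC]ᵏAB   : ∀ k → 0 ℕ.< k → H ((mA · mC) ^ k · mA · mB)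
  [CA]ᵏC²NB : ∀ k {N} → 0 ℕ.< k → G N → H ((mC · mA) ^ k · mC ^ 2 · N · mB)
  [CA]ᵏCBNB : ∀ k {N} → 0 ℕ.< k → G N → H ((mC · mA) ^ k · mC · mB · N · mB)
  [CA]ᵏCB   : ∀ k → 0 ℕ.< k → H ((mC · mA) ^ k · mC · mB)

H′ : Pred Mat 0ℓ
H′ M = H M ⊎ M ≡ I₃

H′-setoid : Setoid 0ℓ 0ℓ
H′-setoid = subsetoid (setoid Mat) H′

H′-rawMonoid : (∀ {M N} → H′ M → H′ N → H′ (M · N)) → RawMonoid 0ℓ 0ℓ
H′-rawMonoid closed = record
  { Carrier = ∃ H′
  ; _≈_     = Setoid._≈_ H′-setoid
  ; _∙_     = λ (M , M∈H′) (N , N∈H′) → M · N , closed M∈H′ N∈H′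
  ; ε       = I₃ , inj₂ refl
  }

toMonoid : {A : Set a} {_≈_ : Rel A ℓ} {_∙_ : Op₂ A} {ε : A} → IsMonoid _≈_ _∙_ ε → Monoid a ℓ
toMonoid isMonoid = record { isMonoid = isMonoid }

module _ (M : Monoid a ℓ) where
  open Monoid M

  product : List Carrier → Carrier
  product = foldr _∙_ ε

  Generates : Pred Carrier ℓ′ → Set (a ⊔ ℓ ⊔ ℓ′)
  Generates X = ∀ m → ∃[ xs ] All X xs × product xs ≈ m

  -- The canonical homomorphism from words over X to M is bijective.
  record IsFreeGeneratingSet (X : Pred Carrier ℓ′) : Set (a ⊔ ℓ ⊔ ℓ′) where
    field
      respects  : X Respects _≈_
      generates : Generates X
      unique    : ∀ {xs ys} → All X xs → All X ys →
                  product xs ≈ product ys → Pointwise _≈_ xs ys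

  FinitelyGenerated : Set (a ⊔ ℓ)
  FinitelyGenerated = ∃[ gs ] Generates (λ m → Any (m ≈_) gs)

Infinite : Setoid a ℓ → Set (a ⊔ ℓ)
Infinite S = Injection (setoid ℕ) S

record Digraph a ℓ ℓ′ : Set (lsuc (a ⊔ ℓ ⊔ ℓ′)) where
  field
    vertices : Setoid a ℓ
  open Setoid vertices public using (_≈_) renaming (Carrier to V)
  field
    _⟶_ : Rel V ℓ′

  data Walk : V → V → Set (a ⊔ ℓ ⊔ ℓ′) where
    stop : ∀ {u v} → u ≈ v → Walk u v
    step : ∀ {u v w} → u ⟶ v → Walk v w → Walk u w

  visited : ∀ {u v} → Walk u v → List V
  visited {u} (stop _)   = u ∷ []
  visited {u} (step _ w) = u ∷ visited w

  -- Every vertex is reached from the root by exactly one directed walk.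
  IsTreeRootedAt : V → Set (a ⊔ ℓ ⊔ ℓ′)
  IsTreeRootedAt r = ∀ v → Σ[ w ∈ Walk r v ] (∀ (w′ : Walk r v) → Pointwise _≈_ (visited w) (visited w′))

  Children : V → Setoid (a ⊔ ℓ′) ℓ
  Children u = subsetoid vertices (u ⟶_)

  -- In a rooted tree, regularity and degree refer to the number of children.
  Regular : Set (a ⊔ ℓ ⊔ ℓ′)
  Regular = ∀ u v → Bijection (Children u) (Children v)

  InfiniteDegrees : Set (a ⊔ ℓ ⊔ ℓ′)
  InfiniteDegrees = ∀ u → Infinite (Children u)

Cayley : (M : Monoid a ℓ) → Pred (Monoid.Carrier M) ℓ′ → Digraph a ℓ (a ⊔ ℓ ⊔ ℓ′)
Cayley M X = record
  { vertices = setoid′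
  ; _⟶_      = λ u v → ∃[ x ] x ∈ X × u ∙ x ≈ v
  }
  where open Monoid M renaming (setoid to setoid′)

{-# OPTIONS --safe #-}

-- For t = (x , y , z), A t = B (x , −y , z) and C t = B (−x , y , z).  The signs of
-- the first two coordinates of B⁻¹ t tell which of A, B, C was applied last, so
-- every primitive triple is W (1,0,1)ᵗ for a unique word W ending in B.  Such a word is a list of
-- blocks, a block being a word in A and C followed by B, and a short computation
-- shows that 2 min(x , y) < z depends on the first block only: call the block
-- good if its triple has this property.  Then 𝒫 and H′ both correspond to the
-- block lists that are empty or start with a good block, multiplication is
-- concatenation, and cutting such a list before each good block shows that the
-- monoid is free on the lists "good block, then bad blocks"; A B, A² B, A³ B, …
-- are among them.
--
-- On the side of lattices, two independent minimal vectors form a basis, so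
-- sin θ is well defined and C(p , q) determines p / q; it is nonempty because
-- (q , 0) and (√(q² − p²) , p) span a member.
module Submission where

open import Defs
open import Level using (Level; 0ℓ)
open import Algebra.Bundles using (Monoid)
open import Algebra.Core using (Op₂)
open import Algebra.Morphism.Structures using (IsMonoidIsomorphism)
open import Algebra.Structures using (IsMonoid)
open import Data.Empty using (⊥-elim)
open import Data.Fin.Base using (toℕ)
open import Data.Fin.Properties using (pigeonhole)
open import Data.Integer.Base using (ℤ; +_; -[1+_]; -_; 0ℤ; 1ℤ; _+_; _-_; _*_; _≤_; _<_; ∣_∣; +≤+; +<+; positive; nonNegative; ≢-nonZero)
import Data.Integer.Divisibility as Unsigned
open import Data.Integer.Divisibility.Signed as ℤ∣ using (divides; ∣ᵤ⇒∣; ∣⇒∣ᵤ) renaming (_∣_ to _∣ℤ_)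
open import Data.Integer.DivMod using (_/ℕ_; _%ℕ_; n%ℕd<d; a≡a%ℕn+[a/ℕn]*n)
open import Data.Integer.GCD using (gcd; gcd-greatest; gcd[i,j]∣i; gcd[i,j]∣j)
import Data.Integer.Properties as ℤ
open import Data.Integer.Tactic.RingSolver using (solve-∀)
open import Data.List.Base using (List; []; _∷_; _++_; concat; length; lookup; map; replicate)
open import Data.List.Properties using (++-assoc; ++-identityʳ; length-replicate; ∷-injective)
open import Data.List.Relation.Binary.Pointwise using (Pointwise; []; _∷_)
open import Data.List.Relation.Unary.All using (All; []; _∷_)
import Data.List.Relation.Unary.All.Properties as All
open import Data.List.Relation.Unary.Any as Any using (Any)
import Data.List.Relation.Unary.Any.Properties as Any
open import Data.Nat.Base as ℕ using (ℕ; zero; suc)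
import Data.Nat.Coprimality as ℕ
import Data.Nat.Divisibility as ℕ
open import Data.Nat.Divisibility using (_∣_; _∤_)
import Data.Nat.GCD as ℕ
open import Data.Nat.Primality using (euclidsLemma; prime[2])
import Data.Nat.Properties as ℕ
import Data.Nat.Tactic.RingSolver as ℕ-Ring
open import Data.Product using (Σ; Σ-syntax; ∃; ∃-syntax; ∃!; _×_; _,_; proj₁; proj₂)
open import Data.Sum.Base using (_⊎_; inj₁; inj₂)
open import Data.Vec.Base as Vec using (Vec; []; _∷_)
open import Data.Vec.Properties using (map-∘; map-cong; map-id)
open import Function.Base using (_∘_)
open import Function.Bundles using (Bijection; _⇔_; mk⇔)
open import Relation.Binary.Bundles using (Setoid)
open import Relation.Binary.Definitions using (tri<; tri≈; tri>)
open import Relation.Binary.PropositionalEquality as ≡ using (_≡_; _≢_)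
open import Relation.Nullary using (¬_; Dec; yes; no)
open import Relation.Unary using (Pred; _∈_; _⊆_; _≐_)
open Sublattice using (b₁; b₂; independent)

-- Monoids with a free generating set

-- Only the first block matters for 2 min(x , y) < z because a letter exchanges the defects of the
-- two legs: if A takes (x , y , z) to (x′ , y′ , z′), then z′ - 2 x′ = 2 y - z, and C does the same
-- with the legs exchanged. Two different letters in a row leave the question as it was, until the
-- block ends or a letter is repeated; hence the alternating powers in `H`. A class is a set of
-- lattices compared by extension, so p / q must be recovered from the members before ψ makes sense.
-- That is why lattice geometry is needed at all. The claims on the Cayley digraph concern every
-- free generating set. Since a free generating set lies in every generating set, the elements A B,
-- A² B, ... found in one of them belong to all.

module FreeMonoid {a ℓ : Level} (𝓜 : Monoid a ℓ) where
  open Monoid 𝓜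

  product-++ : ∀ xs ys → product 𝓜 (xs ++ ys) ≈ product 𝓜 xs ∙ product 𝓜 ys
  product-++ []       ys = sym (identityˡ _)
  product-++ (x ∷ xs) ys = trans (∙-congˡ (product-++ xs ys)) (sym (assoc x _ _))

  module _ {ℓ′} {X : Pred Carrier ℓ′} (free : IsFreeGeneratingSet 𝓜 X) where
    open IsFreeGeneratingSet free

    product≉ε : ∀ {x xs} → All X (x ∷ xs) → ¬ (product 𝓜 (x ∷ xs) ≈ ε)
    product≉ε x∷xs∈X eq with unique x∷xs∈X [] eq
    ... | ()

    private
      last-≈ : ∀ us {x y} → Pointwise _≈_ (us ++ x ∷ []) (us ++ y ∷ []) → x ≈ y
      last-≈ []       (x≈y ∷ []) = x≈y
      last-≈ (u ∷ us) (_ ∷ eq)   = last-≈ us eq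

    -- Once `u` is spelled over `X`, the words for `u ∙ x` and `u ∙ y` can differ in the last letter
    -- only, where uniqueness compares them. This identifies the children of any vertex with the
    -- generators.
    generator-cancelˡ : ∀ u {x y} → X x → X y → u ∙ x ≈ u ∙ y → x ≈ y
    generator-cancelˡ u {x} {y} x∈X y∈X eq =
      let us , us∈X , us≈u = generates u
          extend : ∀ z → product 𝓜 (us ++ z ∷ []) ≈ u ∙ z
          extend z = trans (product-++ us (z ∷ [])) (∙-cong us≈u (identityʳ z))
      in last-≈ us (unique (All.++⁺ us∈X (x∈X ∷ [])) (All.++⁺ us∈X (y∈X ∷ []))
           (trans (extend x) (trans eq (sym (extend y)))))

    private
      first-only : ∀ {x} u us vs → Pointwise _≈_ (x ∷ []) (u ∷ us ++ vs) → x ≈ u × us ≡ []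
      first-only u []      vs (x≈u ∷ _)  = x≈u , ≡.refl
      first-only u (_ ∷ _) vs (_ ∷ ())

    generator-indecomposable : ∀ {x} xs → X x → product 𝓜 xs ≈ x → Any (x ≈_) xs
    generator-indecomposable [] x∈X eq =
      ⊥-elim (product≉ε (x∈X ∷ []) (trans (identityʳ _) (sym eq)))
    generator-indecomposable {x} (y ∷ ys) x∈X eq with generates y | generates (product 𝓜 ys)
    ... | [] , _ , ε≈y | _ =
      Any.there (generator-indecomposable ys x∈X
        (trans (sym (identityˡ _)) (trans (∙-congʳ ε≈y) eq)))
    ... | u ∷ us , us∈X , us≈y | vs , vs∈X , vs≈ys
      with first-only u us vs (unique (x∈X ∷ []) (All.++⁺ us∈X vs∈X)
             (trans (identityʳ x) (trans (sym eq) (trans (sym (∙-cong us≈y vs≈ys)) (sym (product-++ (u ∷ us) vs))))))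
    ...   | x≈u , ≡.refl = Any.here (trans x≈u (trans (sym (identityʳ u)) us≈y))

    module _ {ℓ″} {Y : Pred Carrier ℓ″} (respects-Y : ∀ {x y} → x ≈ y → Y x → Y y) (generates-Y : Generates 𝓜 Y) where

      -- Writing `x` as a product over `Y`, indecomposability makes one factor equal to `x`. It
      -- excludes finite generating sets and compares different free generating sets.
      free⊆generating : X ⊆ Y
      free⊆generating {x} x∈X =
        let ys , ys∈Y , eq = generates-Y x
        in member ys∈Y (generator-indecomposable ys x∈X eq)
        where
        member : ∀ {ys} → All Y ys → Any (x ≈_) ys → Y x
        member (y∈Y ∷ _)  (Any.here x≈y) = respects-Y (sym x≈y) y∈Y
        member (_ ∷ ys∈Y) (Any.there p)  = member ys∈Y p

    open Digraph (Cayley 𝓜 X)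
      using (Walk; stop; step; visited; IsTreeRootedAt; Regular; Children)

    private
      labels : ∀ {u v} → Walk u v → List Carrier
      labels (stop _)             = []
      labels (step (x , _ , _) w) = x ∷ labels w

      labels-X : ∀ {u v} (w : Walk u v) → All X (labels w)
      labels-X (stop _)               = []
      labels-X (step (_ , x∈X , _) w) = x∈X ∷ labels-X w

      labels-product : ∀ {u v} (w : Walk u v) → u ∙ product 𝓜 (labels w) ≈ v
      labels-product (stop u≈v)             = trans (identityʳ _) u≈v
      labels-product (step (x , _ , ux≈v) w) =
        trans (sym (assoc _ x _)) (trans (∙-congʳ ux≈v) (labels-product w))

      walk : ∀ u {v} xs → All X xs → u ∙ product 𝓜 xs ≈ v → Walk u v
      walk u []       []           eq = stop (trans (sym (identityʳ u)) eq)
      walk u (x ∷ xs) (x∈X ∷ xs∈X) eq =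
        step (x , x∈X , refl) (walk (u ∙ x) xs xs∈X (trans (assoc u x _) eq))

      -- The starting points are kept apart because after one step the two walks stand at vertices
      -- that agree only up to `≈`.
      walk-visited : ∀ {u u′ v} xs (xs∈X : All X xs) (eq : u ∙ product 𝓜 xs ≈ v) (w : Walk u′ v) →
        u ≈ u′ → Pointwise _≈_ xs (labels w) → Pointwise _≈_ (visited (walk u xs xs∈X eq)) (visited w)
      walk-visited [] [] eq (stop _) u≈u′ [] = u≈u′ ∷ []
      walk-visited (x ∷ xs) (_ ∷ xs∈X) eq (step (_ , _ , ux≈v) w) u≈u′ (x≈y ∷ xs≈ys) =
        u≈u′ ∷ walk-visited xs xs∈X _ w (trans (∙-cong u≈u′ x≈y) ux≈v) xs≈ys

    -- A walk from `ε` to `v` amounts to a word over `X` with product `v`: existence is generation,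
    -- and uniqueness is freeness.
    cayley-tree : IsTreeRootedAt ε
    cayley-tree v =
      let xs , xs∈X , eq = generates v
          eq′ = trans (identityˡ _) eq
      in walk ε xs xs∈X eq′ , λ w → walk-visited xs xs∈X eq′ w refl
           (unique xs∈X (labels-X w) (trans eq (trans (sym (labels-product w)) (identityˡ _))))

    -- The child of `u` along `x` goes to the child of `v` along `x`. Children are compared as
    -- vertices, without their labels, so cancellation is needed for well-definedness as well as for
    -- injectivity.
    cayley-regular : Regular
    cayley-regular u v = record
      { to        = λ (_ , x , x∈X , _) → v ∙ x , x , x∈X , refl
      ; cong      = λ {c} {d} → translate u v c d
      ; bijective = (λ {c} {d} eq → reflect c d eq) ,
                    λ (_ , x , x∈X , vx≈y) → (u ∙ x , x , x∈X , refl) ,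
                      λ {c} eq → trans (translate u v c (u ∙ x , x , x∈X , refl) eq) vx≈y
      }
      where
      translate : ∀ u v ((c , x , _) (d , y , _) : Σ Carrier λ c → ∃[ x ] x ∈ X × u ∙ x ≈ c) →
        c ≈ d → v ∙ x ≈ v ∙ y
      translate u v (_ , x , x∈X , ux≈c) (_ , y , y∈X , uy≈d) c≈d =
        ∙-congˡ (generator-cancelˡ u x∈X y∈X (trans ux≈c (trans c≈d (sym uy≈d))))
      reflect : ∀ ((c , x , _) (d , y , _) : Σ Carrier λ c → ∃[ x ] x ∈ X × u ∙ x ≈ c) →
        v ∙ x ≈ v ∙ y → c ≈ d
      reflect (_ , x , x∈X , ux≈c) (_ , y , y∈X , uy≈d) eq =
        trans (sym ux≈c) (trans (∙-congˡ (generator-cancelˡ v x∈X y∈X eq)) uy≈d)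

    module _ (g : ℕ → Carrier) (g∈X : ∀ n → X (g n)) (g-injective : ∀ {m n} → g m ≈ g n → m ≡ n) where

      vertices-infinite : Infinite setoid
      vertices-infinite = record { to = g ; cong = reflexive ∘ ≡.cong g ; injective = g-injective }

      cayley-infiniteDegrees : ∀ u → Infinite (Children u)
      cayley-infiniteDegrees u = record
        { to        = λ n → u ∙ g n , g n , g∈X n , refl
        ; cong      = λ m≡n → ∙-congˡ (reflexive (≡.cong g m≡n))
        ; injective = λ {m} {n} eq → g-injective (generator-cancelˡ u (g∈X m) (g∈X n) eq)
        }

      non-commutative : ¬ (g 0 ∙ g 1 ≈ g 1 ∙ g 0)
      non-commutative eq with unique (g∈X 0 ∷ g∈X 1 ∷ []) (g∈X 1 ∷ g∈X 0 ∷ [])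
          (trans (∙-congˡ (identityʳ _)) (trans eq (sym (∙-congˡ (identityʳ _)))))
      ... | g0≈g1 ∷ _ with g-injective g0≈g1
      ...   | ()

      not-finitelyGenerated : ¬ FinitelyGenerated 𝓜
      not-finitelyGenerated (gs , generates-gs) =
        -- Each `g n` must occur in the list `gs`, so two of `g 0`, ..., `g (length gs)` share a
        -- position.
        let i , j , i<j , fi≡fj = pigeonhole (ℕ.n<1+n (length gs)) (λ i → Any.index (g∈gs (toℕ i)))
        in ℕ.<⇒≢ i<j (g-injective (trans (Any.lookup-index (g∈gs (toℕ i)))
             (trans (reflexive (≡.cong (lookup gs) fi≡fj)) (sym (Any.lookup-index (g∈gs (toℕ j)))))))
        where
        g∈gs : ∀ n → Any (g n ≈_) gs
        g∈gs n = free⊆generating (λ x≈y → Any.map (trans (sym x≈y))) generates-gs (g∈X n)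

open ≡ using (refl; sym; trans; cong; cong₂; subst; subst₂)

-- Order on the integers

0<+ : ∀ {i j} → 0ℤ < i → 0ℤ ≤ j → 0ℤ < i + j
0<+ = ℤ.+-mono-<-≤

0≤+ : ∀ {i j} → 0ℤ ≤ i → 0ℤ ≤ j → 0ℤ ≤ i + j
0≤+ = ℤ.+-mono-≤

0<* : ∀ {i j} → 0ℤ < i → 0ℤ < j → 0ℤ < i * j
0<* {i} {j} 0<i 0<j = subst (_< i * j) (ℤ.*-zeroʳ i) (ℤ.*-monoˡ-<-pos i {{positive 0<i}} 0<j)

0≤* : ∀ {i j} → 0ℤ ≤ i → 0ℤ ≤ j → 0ℤ ≤ i * j
0≤* {i} {j} 0≤i 0≤j = subst (_≤ i * j) (ℤ.*-zeroʳ i) (ℤ.*-monoˡ-≤-nonNeg i {{nonNegative 0≤i}} 0≤j)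

i<j⇒0<j-i : ∀ {i j} → i < j → 0ℤ < j - i
i<j⇒0<j-i {i} {j} i<j = subst (_< j - i) (ℤ.+-inverseʳ i) (ℤ.+-monoˡ-< (- i) i<j)

0<j-i⇒i<j : ∀ {i j} → 0ℤ < j - i → i < j
0<j-i⇒i<j {i} {j} p = subst₂ _<_ (ℤ.+-identityˡ i) (solved j i) (ℤ.+-monoˡ-< i p)
  where
  solved : ∀ j i → j - i + i ≡ j
  solved = solve-∀

-- Inequalities are proved by certificates: `k` is an expression of visible sign, and a ring
-- identity equates it with the difference of the two sides.
<-by : ∀ {i j} k → 0ℤ < k → k ≡ j - i → i < j
<-by _ 0<k eq = 0<j-i⇒i<j (subst (0ℤ <_) eq 0<k)

≤-by : ∀ {i j} k → 0ℤ ≤ k → k ≡ j - i → i ≤ j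
≤-by _ 0≤k eq = ℤ.0≤i-j⇒j≤i (subst (0ℤ ≤_) eq 0≤k)

<⇔<-by : ∀ {i j k l} → j - i ≡ l - k → (i < j → k < l) × (k < l → i < j)
<⇔<-by eq = (λ p → <-by _ (i<j⇒0<j-i p) eq) , (λ p → <-by _ (i<j⇒0<j-i p) (sym eq))

0<2 : 0ℤ < + 2
0<2 = +<+ (ℕ.s≤s ℕ.z≤n)

0≤2 : 0ℤ ≤ + 2
0≤2 = ℤ.<⇒≤ 0<2

0≤i*i : ∀ i → 0ℤ ≤ i * i
0≤i*i (+ n)    = 0≤* {+ n} {+ n} (+≤+ ℕ.z≤n) (+≤+ ℕ.z≤n)
0≤i*i -[1+ n ] = +≤+ ℕ.z≤n

square-cancel-< : ∀ {i j} → 0ℤ ≤ j → i * i < j * j → i < j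
square-cancel-< {i} {j} 0≤j ii<jj with i ℤ.<? j
... | yes i<j = i<j
... | no i≮j = ⊥-elim (ℤ.<⇒≱ ii<jj
    (ℤ.≤-trans (ℤ.*-monoˡ-≤-nonNeg j {{nonNegative 0≤j}} j≤i)
               (ℤ.*-monoʳ-≤-nonNeg i {{nonNegative (ℤ.≤-trans 0≤j j≤i)}} j≤i)))
  where j≤i = ℤ.≮⇒≥ i≮j

square-cancel-≤ : ∀ {i j} → 0ℤ ≤ j → i * i ≤ j * j → i ≤ j
square-cancel-≤ {i} {j} 0≤j ii≤jj with i ℤ.≤? j
... | yes i≤j = i≤j
... | no i≰j = ⊥-elim (ℤ.<⇒≱
    (ℤ.≤-<-trans (ℤ.*-monoˡ-≤-nonNeg j {{nonNegative 0≤j}} (ℤ.<⇒≤ j<i))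
               (ℤ.*-monoʳ-<-pos i {{positive (ℤ.≤-<-trans 0≤j j<i)}} j<i)) ii≤jj)
  where j<i = ℤ.≰⇒> i≰j

-- Berggren's tree of primitive Pythagorean triples

private
  B-even : ∀ x y z → + 2 * (x + z) + y ≡ + 2 * x + y + + 2 * z
  B-even = solve-∀

  B⁻¹B-x : ∀ x y z → let x′ = x + + 2 * y + + 2 * z ; y′ = + 2 * x + y + + 2 * z ; z′ = + 2 * x + + 2 * y + + 3 * z in
    1ℤ * x′ + + 2 * y′ + - + 2 * z′ ≡ x
  B⁻¹B-x = solve-∀

  B⁻¹B-y : ∀ x y z → let x′ = x + + 2 * y + + 2 * z ; y′ = + 2 * x + y + + 2 * z ; z′ = + 2 * x + + 2 * y + + 3 * z in
    + 2 * x′ + 1ℤ * y′ + - + 2 * z′ ≡ y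
  B⁻¹B-y = solve-∀

  B⁻¹B-z : ∀ x y z → let x′ = x + + 2 * y + + 2 * z ; y′ = + 2 * x + y + + 2 * z ; z′ = + 2 * x + + 2 * y + + 3 * z in
    - + 2 * x′ + - + 2 * y′ + + 3 * z′ ≡ z
  B⁻¹B-z = solve-∀

  B-form : ∀ x y z → let x′ = x + + 2 * y + + 2 * z ; y′ = + 2 * x + y + + 2 * z ; z′ = + 2 * x + + 2 * y + + 3 * z in
    x′ * x′ + y′ * y′ - z′ * z′ ≡ x * x + y * y - z * z
  B-form = solve-∀

-- The part of primitivity that survives sign changes. Coprimality speaks of common divisors, so
-- that its transport along B only needs the old coordinates as integer combinations of the new
-- ones.
record Core (x y z : ℤ) : Set where
  constructor core
  field
    even    : + 2 ∣ℤ y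
    coprime : ∀ {d} → d ∣ℤ x → d ∣ℤ y → d ∣ℤ z → d ∣ℤ 1ℤ
    pythagorean : x * x + y * y ≡ z * z

∣-neg⁻¹ : ∀ {d i} → d ∣ℤ - i → d ∣ℤ i
∣-neg⁻¹ {d} {i} d∣-i = subst (d ∣ℤ_) (ℤ.neg-involutive i) (ℤ∣.∣m⇒∣-m d∣-i)

*-square-neg : ∀ i → - i * - i ≡ i * i
*-square-neg = solve-∀

∣-lin₃ : ∀ {d i j k} a b c → d ∣ℤ i → d ∣ℤ j → d ∣ℤ k → d ∣ℤ a * i + b * j + c * k
∣-lin₃ a b c p q r = ℤ∣.∣m∣n⇒∣m+n (ℤ∣.∣m∣n⇒∣m+n (ℤ∣.∣n⇒∣m*n a p) (ℤ∣.∣n⇒∣m*n b q)) (ℤ∣.∣n⇒∣m*n c r)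

module _ {x y z : ℤ} (t : Core x y z) where
  open Core t

  core-neg-x : Core (- x) y z
  core-neg-x = core even (coprime ∘ ∣-neg⁻¹) (trans (cong (_+ y * y) (*-square-neg x)) pythagorean)

  core-neg-y : Core x (- y) z
  core-neg-y = core (ℤ∣.∣m⇒∣-m even) (λ p → coprime p ∘ ∣-neg⁻¹)
    (trans (cong (_+_ (x * x)) (*-square-neg y)) pythagorean)

  core-B : Core (x + + 2 * y + + 2 * z) (+ 2 * x + y + + 2 * z) (+ 2 * x + + 2 * y + + 3 * z)
  core-B = core
    (subst (+ 2 ∣ℤ_) (B-even x y z) (ℤ∣.∣m∣n⇒∣m+n (ℤ∣.∣m⇒∣m*n (x + z) ℤ∣.∣-refl) even))
    (λ {d} p q r → coprime
      (subst (d ∣ℤ_) (B⁻¹B-x x y z) (∣-lin₃ 1ℤ (+ 2) (- + 2) p q r))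
      (subst (d ∣ℤ_) (B⁻¹B-y x y z) (∣-lin₃ (+ 2) 1ℤ (- + 2) p q r))
      (subst (d ∣ℤ_) (B⁻¹B-z x y z) (∣-lin₃ (- + 2) (- + 2) (+ 3) p q r)))
    (ℤ.i-j≡0⇒i≡j _ _ (trans (B-form x y z) (ℤ.i≡j⇒i-j≡0 pythagorean)))

  core-neg-z : Core x y (- z)
  core-neg-z = core even (λ p q → coprime p q ∘ ∣-neg⁻¹) (trans pythagorean (sym (*-square-neg z)))

record Primitive₀ (x y z : ℤ) : Set where
  constructor primitive₀
  field
    0<x : 0ℤ < x
    0≤y : 0ℤ ≤ y
    0<z : 0ℤ < z
    isCore : Core x y z
  open Core isCore public

private
  leg-difference : ∀ x y → x * x ≡ x * x + y * y - y * y
  leg-difference = solve-∀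

  leg-difference′ : ∀ x y → y * y ≡ x * x + y * y - x * x
  leg-difference′ = solve-∀

module _ {x y z : ℤ} (t : Primitive₀ x y z) where
  open Primitive₀ t

  y<z : y < z
  y<z = square-cancel-< (ℤ.<⇒≤ 0<z)
    (<-by (x * x) (0<* 0<x 0<x) (trans (leg-difference x y) (cong (_- y * y) pythagorean)))

  x≤z : x ≤ z
  x≤z = square-cancel-≤ (ℤ.<⇒≤ 0<z)
    (≤-by (y * y) (0≤i*i y) (trans (leg-difference′ x y) (cong (_- x * x) pythagorean)))

-- The block l₁ … lₙ stands for the word l₁ ⋯ lₙ B.

data Letter : Set where
  α γ : Letter

Block : Set
Block = List Letter

other : Letter → Letter
other α = γ
other γ = α

negate : Letter → Triple → Triple
negate α (x ∷ y ∷ z ∷ []) = x ∷ - y ∷ z ∷ []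
negate γ (x ∷ y ∷ z ∷ []) = - x ∷ y ∷ z ∷ []

-- `β⁻¹` is J B J with J = diag(1 , 1 , -1); it inverts B because B is symmetric and preserves x² +
-- y² - z². In this form it inherits `Core` from `core-B` and two sign changes.
β β⁻¹ : Triple → Triple
β (x ∷ y ∷ z ∷ []) =
  x + + 2 * y + + 2 * z ∷
  + 2 * x + y + + 2 * z ∷
  + 2 * x + + 2 * y + + 3 * z ∷ []
β⁻¹ (x ∷ y ∷ z ∷ []) =
  x + + 2 * y + + 2 * - z ∷
  + 2 * x + y + + 2 * - z ∷
  - (+ 2 * x + + 2 * y + + 3 * - z) ∷ []

act : Letter → Triple → Triple
act l t = β (negate l t)

block : Block → Triple → Triple
block []      t = β t
block (l ∷ b) t = act l (block b t)

triple : List Block → Triple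
triple []       = e
triple (b ∷ bs) = block b (triple bs)

-- The pairing serves two purposes: `negate l` flips `coord (other l)`, while a good block starting
-- with `l` makes `coord l` the short leg.
coord : Letter → Triple → ℤ
coord α (x ∷ y ∷ z ∷ []) = x
coord γ (x ∷ y ∷ z ∷ []) = y

hyp : Triple → ℤ
hyp (x ∷ y ∷ z ∷ []) = z

-- `P₀` admits the root `e`, and `P` excludes it. The letters act on `P` only: at the root, A agrees
-- with B and C fixes `e`, so that words would not be unique.
P₀ P : Pred Triple _
P₀ (x ∷ y ∷ z ∷ []) = Primitive₀ x y z
P t@(x ∷ y ∷ z ∷ []) = P₀ t × 0ℤ < y

e∈P₀ : P₀ e
e∈P₀ = primitive₀ (+<+ (ℕ.s≤s ℕ.z≤n)) (+≤+ ℕ.z≤n) (+<+ (ℕ.s≤s ℕ.z≤n))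
  (core (divides 0ℤ refl) (λ p _ _ → p) refl)

P⇒P₀ : ∀ t → P t → P₀ t
P⇒P₀ (x ∷ y ∷ z ∷ []) = proj₁

β-P : ∀ t → P₀ t → P (β t)
β-P (x ∷ y ∷ z ∷ []) t = primitive₀
    (0<+ (0<+ 0<x (0≤* 0≤2 0≤y)) (0≤* 0≤2 0≤z))
    (ℤ.<⇒≤ 0<y′)
    (0<+ (0<+ (0<* 0<2 0<x) (0≤* 0≤2 0≤y)) (0≤* {+ 3} (+≤+ ℕ.z≤n) 0≤z))
    (core-B isCore)
  , 0<y′
  where
  open Primitive₀ t
  0≤z = ℤ.<⇒≤ 0<z
  0<y′ = 0<+ (0<+ (0<* 0<2 0<x) 0≤y) (0≤* 0≤2 0≤z)

private
  αx-eq : ∀ x y z → x + + 2 * (z - y) ≡ x + + 2 * - y + + 2 * z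
  αx-eq = solve-∀
  αy-eq : ∀ x y z → + 2 * x + (z - y) + z ≡ + 2 * x + - y + + 2 * z
  αy-eq = solve-∀
  αz-eq : ∀ x y z → + 2 * x + + 2 * (z - y) + z ≡ + 2 * x + + 2 * - y + + 3 * z
  αz-eq = solve-∀
  γx-eq : ∀ x y z → + 2 * y + (z - x) + z ≡ - x + + 2 * y + + 2 * z
  γx-eq = solve-∀
  γy-eq : ∀ x y z → y + + 2 * (z - x) ≡ + 2 * - x + y + + 2 * z
  γy-eq = solve-∀
  γz-eq : ∀ x y z → + 2 * y + + 2 * (z - x) + z ≡ + 2 * - x + + 2 * y + + 3 * z
  γz-eq = solve-∀

-- A leg does not exceed the hypotenuse, so after the sign change the coordinates are still sums of
-- nonnegative terms once grouped around `z - y` or `z - x`.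
act-P : ∀ l t → P t → P (act l t)
act-P α (x ∷ y ∷ z ∷ []) (t , 0<y) = primitive₀
    (subst (0ℤ <_) (αx-eq x y z) (0<+ 0<x (0≤* 0≤2 0≤z-y)))
    (ℤ.<⇒≤ 0<y′)
    (subst (0ℤ <_) (αz-eq x y z) (0<+ (0<+ (0<* 0<2 0<x) (0≤* 0≤2 0≤z-y)) (ℤ.<⇒≤ 0<z)))
    (core-B (core-neg-y isCore))
  , 0<y′
  where
  open Primitive₀ t
  0≤z-y = ℤ.<⇒≤ (i<j⇒0<j-i (y<z t))
  0<y′ = subst (0ℤ <_) (αy-eq x y z) (0<+ (0<+ (0<* 0<2 0<x) 0≤z-y) (ℤ.<⇒≤ 0<z))
act-P γ (x ∷ y ∷ z ∷ []) (t , 0<y) = primitive₀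
    (subst (0ℤ <_) (γx-eq x y z) (0<+ (0<+ (0<* 0<2 0<y) 0≤z-x) (ℤ.<⇒≤ 0<z)))
    (ℤ.<⇒≤ 0<y′)
    (subst (0ℤ <_) (γz-eq x y z) (0<+ (0<+ (0<* 0<2 0<y) (0≤* 0≤2 0≤z-x)) (ℤ.<⇒≤ 0<z)))
    (core-B (core-neg-x isCore))
  , 0<y′
  where
  open Primitive₀ t
  0≤z-x = ℤ.i≤j⇒0≤j-i (x≤z t)
  0<y′ = subst (0ℤ <_) (γy-eq x y z) (0<+ 0<y (0≤* 0≤2 0≤z-x))

block-P : ∀ b t → P₀ t → P (block b t)
block-P []      t p = β-P t p
block-P (l ∷ b) t p = act-P l (block b t) (block-P b t p)

triple-P₀ : ∀ bs → P₀ (triple bs)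
triple-P : ∀ b bs → P (triple (b ∷ bs))

triple-P₀ []       = e∈P₀
triple-P₀ (b ∷ bs) = P⇒P₀ _ (triple-P b bs)
triple-P b bs = block-P b (triple bs) (triple-P₀ bs)

triple-ext : ∀ s t → coord α s ≡ coord α t → coord γ s ≡ coord γ t → hyp s ≡ hyp t → s ≡ t
triple-ext (x ∷ y ∷ z ∷ []) (_ ∷ _ ∷ _ ∷ []) refl refl refl = refl

private
  β⁻¹β-z : ∀ x y z → let x′ = x + + 2 * y + + 2 * z ; y′ = + 2 * x + y + + 2 * z ; z′ = + 2 * x + + 2 * y + + 3 * z in
    - (+ 2 * x′ + + 2 * y′ + + 3 * - z′) ≡ z
  β⁻¹β-z = solve-∀
  β⁻¹β-x : ∀ x y z → let x′ = x + + 2 * y + + 2 * z ; y′ = + 2 * x + y + + 2 * z ; z′ = + 2 * x + + 2 * y + + 3 * z in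
    x′ + + 2 * y′ + + 2 * - z′ ≡ x
  β⁻¹β-x = solve-∀
  β⁻¹β-y : ∀ x y z → let x′ = x + + 2 * y + + 2 * z ; y′ = + 2 * x + y + + 2 * z ; z′ = + 2 * x + + 2 * y + + 3 * z in
    + 2 * x′ + y′ + + 2 * - z′ ≡ y
  β⁻¹β-y = solve-∀
  ββ⁻¹-x : ∀ x y z → let x′ = x + + 2 * y + + 2 * - z ; y′ = + 2 * x + y + + 2 * - z ; z′ = - (+ 2 * x + + 2 * y + + 3 * - z) in
    x′ + + 2 * y′ + + 2 * z′ ≡ x
  ββ⁻¹-x = solve-∀
  ββ⁻¹-y : ∀ x y z → let x′ = x + + 2 * y + + 2 * - z ; y′ = + 2 * x + y + + 2 * - z ; z′ = - (+ 2 * x + + 2 * y + + 3 * - z) in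
    + 2 * x′ + y′ + + 2 * z′ ≡ y
  ββ⁻¹-y = solve-∀
  ββ⁻¹-z : ∀ x y z → let x′ = x + + 2 * y + + 2 * - z ; y′ = + 2 * x + y + + 2 * - z ; z′ = - (+ 2 * x + + 2 * y + + 3 * - z) in
    + 2 * x′ + + 2 * y′ + + 3 * z′ ≡ z
  ββ⁻¹-z = solve-∀

β⁻¹∘β : ∀ t → β⁻¹ (β t) ≡ t
β⁻¹∘β t = triple-ext _ _ (eq-x t) (eq-y t) (eq-z t)
  where
  eq-x : ∀ t → coord α (β⁻¹ (β t)) ≡ coord α t
  eq-x (x ∷ y ∷ z ∷ []) = β⁻¹β-x x y z
  eq-y : ∀ t → coord γ (β⁻¹ (β t)) ≡ coord γ t
  eq-y (x ∷ y ∷ z ∷ []) = β⁻¹β-y x y z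
  eq-z : ∀ t → hyp (β⁻¹ (β t)) ≡ hyp t
  eq-z (x ∷ y ∷ z ∷ []) = β⁻¹β-z x y z

β∘β⁻¹ : ∀ t → β (β⁻¹ t) ≡ t
β∘β⁻¹ t = triple-ext _ _ (eq-x t) (eq-y t) (eq-z t)
  where
  eq-x : ∀ t → coord α (β (β⁻¹ t)) ≡ coord α t
  eq-x (x ∷ y ∷ z ∷ []) = ββ⁻¹-x x y z
  eq-y : ∀ t → coord γ (β (β⁻¹ t)) ≡ coord γ t
  eq-y (x ∷ y ∷ z ∷ []) = ββ⁻¹-y x y z
  eq-z : ∀ t → hyp (β (β⁻¹ t)) ≡ hyp t
  eq-z (x ∷ y ∷ z ∷ []) = ββ⁻¹-z x y z

β-injective : ∀ {s t} → β s ≡ β t → s ≡ t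
β-injective {s} {t} eq = trans (sym (β⁻¹∘β s)) (trans (cong β⁻¹ eq) (β⁻¹∘β t))

negate-involutive : ∀ l t → negate l (negate l t) ≡ t
negate-involutive α (x ∷ y ∷ z ∷ []) = triple-ext _ _ refl (ℤ.neg-involutive y) refl
negate-involutive γ (x ∷ y ∷ z ∷ []) = triple-ext _ _ (ℤ.neg-involutive x) refl refl

negate-injective : ∀ l {s t} → negate l s ≡ negate l t → s ≡ t
negate-injective l {s} {t} eq =
  trans (sym (negate-involutive l s)) (trans (cong (negate l) eq) (negate-involutive l t))

coord-negate : ∀ l t → coord l (negate (other l) t) ≡ - coord l t
coord-negate α (x ∷ y ∷ z ∷ []) = refl
coord-negate γ (x ∷ y ∷ z ∷ []) = refl

coord-negate′ : ∀ l t → coord l (negate l t) ≡ coord l t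
coord-negate′ α (x ∷ y ∷ z ∷ []) = refl
coord-negate′ γ (x ∷ y ∷ z ∷ []) = refl

coord-P : ∀ l t → P t → 0ℤ < coord l t
coord-P α (x ∷ y ∷ z ∷ []) (t , _)   = Primitive₀.0<x t
coord-P γ (x ∷ y ∷ z ∷ []) (_ , 0<y) = 0<y

coord-P₀ : ∀ l t → P₀ t → 0ℤ ≤ coord l t
coord-P₀ α (x ∷ y ∷ z ∷ []) t = ℤ.<⇒≤ (Primitive₀.0<x t)
coord-P₀ γ (x ∷ y ∷ z ∷ []) t = Primitive₀.0≤y t

-- Weak on one side, since the triple under a plain B may be the root with second coordinate 0;
-- strict on the other, where a letter has flipped a positive coordinate.
nonNeg≢neg : ∀ {i j} → 0ℤ ≤ i → 0ℤ < j → i ≢ - j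
nonNeg≢neg 0≤i 0<j refl = ℤ.<⇒≱ (ℤ.neg-mono-< 0<j) 0≤i

other-involutive : ∀ l → other (other l) ≡ l
other-involutive α = refl
other-involutive γ = refl

β≢act : ∀ l {s t} → P₀ s → P t → β s ≢ act l t
β≢act l {s} {t} s∈ t∈ eq = nonNeg≢neg (coord-P₀ (other l) s s∈) (coord-P (other l) t t∈)
  (trans (cong (coord (other l)) (trans (β-injective {s} eq) (cong (λ l → negate l t) (sym (other-involutive l)))))
    (coord-negate (other l) t))

act≢act : ∀ l {s t} → P s → P t → act l s ≢ act (other l) t
act≢act l {s} {t} s∈ t∈ eq = nonNeg≢neg (ℤ.<⇒≤ (coord-P l s s∈)) (coord-P l t t∈)
  (trans (sym (coord-negate′ l s)) (trans (cong (coord l) (β-injective eq)) (coord-negate l t)))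

block-injective : ∀ b b′ {s t} → P₀ s → P₀ t → block b s ≡ block b′ t → b ≡ b′ × s ≡ t
block-injective [] [] {s} s∈ t∈ eq = refl , β-injective {s} eq
block-injective [] (l ∷ b′) s∈ t∈ eq = ⊥-elim (β≢act l s∈ (block-P b′ _ t∈) eq)
block-injective (l ∷ b) [] s∈ t∈ eq = ⊥-elim (β≢act l t∈ (block-P b _ s∈) (sym eq))
block-injective (α ∷ b) (α ∷ b′) s∈ t∈ eq with block-injective b b′ s∈ t∈ (negate-injective α (β-injective eq))
... | refl , s≡t = refl , s≡t
block-injective (γ ∷ b) (γ ∷ b′) s∈ t∈ eq with block-injective b b′ s∈ t∈ (negate-injective γ (β-injective eq))
... | refl , s≡t = refl , s≡t
block-injective (α ∷ b) (γ ∷ b′) s∈ t∈ eq = ⊥-elim (act≢act α (block-P b _ s∈) (block-P b′ _ t∈) eq)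
block-injective (γ ∷ b) (α ∷ b′) s∈ t∈ eq = ⊥-elim (act≢act γ (block-P b _ s∈) (block-P b′ _ t∈) eq)

e∉P : ¬ P e
e∉P (_ , +<+ ())

triple-injective : ∀ bs cs → triple bs ≡ triple cs → bs ≡ cs
triple-injective [] [] eq = refl
triple-injective [] (c ∷ cs) eq = ⊥-elim (e∉P (subst P (sym eq) (triple-P c cs)))
triple-injective (b ∷ bs) [] eq = ⊥-elim (e∉P (subst P eq (triple-P b bs)))
triple-injective (b ∷ bs) (c ∷ cs) eq with block-injective b c (triple-P₀ bs) (triple-P₀ cs) eq
... | refl , eq′ = cong (b ∷_) (triple-injective bs cs eq′)

0<*⇒0< : ∀ {i j} → 0ℤ < i → 0ℤ < i * j → 0ℤ < j
0<*⇒0< {i} {j} 0<i 0<ij =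
  ℤ.*-cancelˡ-<-nonNeg i {{nonNegative (ℤ.<⇒≤ 0<i)}} (subst (_< i * j) (sym (ℤ.*-zeroʳ i)) 0<ij)

0≤*⇒0≤ : ∀ {i j} → 0ℤ < i → 0ℤ ≤ i * j → 0ℤ ≤ j
0≤*⇒0≤ {i} {j} 0<i 0≤ij =
  ℤ.*-cancelˡ-≤-pos 0ℤ j i {{positive 0<i}} (subst (_≤ i * j) (sym (ℤ.*-zeroʳ i)) 0≤ij)

square-injective : ∀ {i j} → 0ℤ ≤ i → 0ℤ ≤ j → i * i ≡ j * j → i ≡ j
square-injective 0≤i 0≤j eq = ℤ.≤-antisym
  (square-cancel-≤ 0≤j (ℤ.≤-reflexive eq)) (square-cancel-≤ 0≤i (ℤ.≤-reflexive (sym eq)))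

square-≡⇒∣ : ∀ i j → i * i ≡ j * j → i ∣ℤ j
square-≡⇒∣ i j eq with ℤ.i*j≡0⇒i≡0∨j≡0 (i - j) (trans (factor i j) (ℤ.i≡j⇒i-j≡0 eq))
  where
  factor : ∀ i j → (i - j) * (i + j) ≡ i * i - j * j
  factor = solve-∀
... | inj₁ i-j≡0 = subst (i ∣ℤ_) (ℤ.i-j≡0⇒i≡j i j i-j≡0) ℤ∣.∣-refl
... | inj₂ i+j≡0 = ∣-neg⁻¹ (subst (i ∣ℤ_) (negated i j i+j≡0) ℤ∣.∣-refl)
  where
  cancel : ∀ i j → (i + j) - j ≡ i
  cancel = solve-∀
  negated : ∀ i j → i + j ≡ 0ℤ → i ≡ - j
  negated i j eq = trans (sym (cancel i j)) (trans (cong (_- j) eq) (ℤ.+-identityˡ (- j)))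

2∤1 : ¬ (+ 2 ∣ℤ 1ℤ)
2∤1 2∣1 with ℕ.∣1⇒≡1 (∣⇒∣ᵤ 2∣1)
... | ()

-- With `x` zero, y² = z² makes `y` a divisor of all three coordinates and hence of 1, although it
-- is even. Parity thus breaks the symmetry of the legs: only the second can vanish, and it does so
-- at the root.
core-x≢0 : ∀ {x y z} → Core x y z → x ≢ 0ℤ
core-x≢0 {x} {y} {z} t x≡0 = 2∤1 (ℤ∣.∣-trans even
  (coprime (subst (y ∣ℤ_) (sym x≡0) (divides 0ℤ refl)) ℤ∣.∣-refl
    (square-≡⇒∣ y z (trans (sym (ℤ.+-identityˡ (y * y))) (trans (cong (λ x → x * x + y * y) (sym x≡0)) pythagorean)))))
  where open Core t

-- If `y` is 0 then `x` and `z` agree, and coprimality leaves only 1.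
P₀⇒P⊎e : ∀ t → P₀ t → P t ⊎ t ≡ e
P₀⇒P⊎e (x ∷ y ∷ z ∷ []) t with 0ℤ ℤ.<? y
... | yes 0<y = inj₁ (t , 0<y)
... | no 0≮y = inj₂ (triple-ext _ e x≡1 y≡0 (trans (sym x≡z) x≡1))
  where
  open Primitive₀ t
  y≡0 : y ≡ 0ℤ
  y≡0 = ℤ.≤-antisym (ℤ.≮⇒≥ 0≮y) 0≤y
  x≡z : x ≡ z
  x≡z = square-injective (ℤ.<⇒≤ 0<x) (ℤ.<⇒≤ 0<z)
    (trans (sym (ℤ.+-identityʳ (x * x))) (trans (cong (λ y → x * x + y * y) (sym y≡0)) pythagorean))
  ∣x∣≡1 : ∣ x ∣ ≡ 1
  ∣x∣≡1 = ℕ.∣1⇒≡1 (∣⇒∣ᵤ (coprime ℤ∣.∣-refl (subst (x ∣ℤ_) (sym y≡0) (divides 0ℤ refl)) (subst (x ∣ℤ_) x≡z ℤ∣.∣-refl)))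
  x≡1 : x ≡ 1ℤ
  x≡1 = trans (sym (ℤ.0≤i⇒+∣i∣≡i (ℤ.<⇒≤ 0<x))) (cong +_ ∣x∣≡1)

data Parent (t : Triple) : Set where
  via-β   : ∀ s → P₀ s → hyp s < hyp t → β s ≡ t → Parent t
  via-act : ∀ l s → P s → hyp s < hyp t → act l s ≡ t → Parent t

-- The term x² + y² − z², which vanishes on Pythagorean triples, makes these ring identities.
private
  z′>0-eq : ∀ x y z → z * z + + 4 * ((x - y) * (x - y)) ≡
    (+ 3 * z) * (+ 3 * z) - (+ 2 * x + + 2 * y) * (+ 2 * x + + 2 * y) + + 8 * (x * x + y * y - z * z)
  z′>0-eq = solve-∀
  z′<z-eq : ∀ x y z → + 2 * (x * y) + (x * x + y * y - z * z) ≡ (x + y) * (x + y) - z * z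
  z′<z-eq = solve-∀
  x′<0-eq : ∀ x y z → (+ 2 * z - (x + + 2 * y)) * (+ 2 * z + (x + + 2 * y)) + + 4 * (x * x + y * y - z * z) ≡
    x * (+ 3 * x - + 4 * y)
  x′<0-eq = solve-∀
  y′≤0-eq : ∀ x y z → (+ 2 * z - (+ 2 * x + y)) * (+ 2 * z + (+ 2 * x + y)) + + 4 * (x * x + y * y - z * z) ≡
    y * (+ 3 * y - + 4 * x)
  y′≤0-eq = solve-∀
  z′-eq : ∀ x y z → + 3 * z - (+ 2 * x + + 2 * y) ≡ - (+ 2 * x + + 2 * y + + 3 * - z)
  z′-eq = solve-∀
  z-z′-eq : ∀ x y z → + 2 * (x + y - z) ≡ z - - (+ 2 * x + + 2 * y + + 3 * - z)
  z-z′-eq = solve-∀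
  x′-eq : ∀ x y z → 0ℤ - (x + + 2 * y + + 2 * - z) ≡ + 2 * z - (x + + 2 * y)
  x′-eq = solve-∀
  y′-eq : ∀ x y z → 0ℤ - (+ 2 * x + y + + 2 * - z) ≡ + 2 * z - (+ 2 * x + y)
  y′-eq = solve-∀
  sum-eq : ∀ x y → (+ 3 * x - + 4 * y) + (+ 3 * y - + 4 * x) ≡ 0ℤ - (x + y)
  sum-eq = solve-∀

  +0* : ∀ k {i n} → n ≡ 0ℤ → i + k * n ≡ i
  +0* k {i} refl = trans (cong (_+_ i) (ℤ.*-zeroʳ k)) (ℤ.+-identityʳ i)

  +0 : ∀ {i n} → n ≡ 0ℤ → i + n ≡ i
  +0 {i} refl = ℤ.+-identityʳ i

module _ {x y z : ℤ} (t : Primitive₀ x y z) (0<y : 0ℤ < y) where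
  open Primitive₀ t
  private
    x′ = x + + 2 * y + + 2 * - z
    y′ = + 2 * x + y + + 2 * - z
    z′ = - (+ 2 * x + + 2 * y + + 3 * - z)

    zero-form : x * x + y * y - z * z ≡ 0ℤ
    zero-form = ℤ.i≡j⇒i-j≡0 pythagorean

    0≤z : 0ℤ ≤ z
    0≤z = ℤ.<⇒≤ 0<z

  -- On a Pythagorean triple, (3 z)² exceeds (2 x + 2 y)² by z² + 4 (x - y)².
  parent-0<z : 0ℤ < z′
  parent-0<z = subst (0ℤ <_) (z′-eq x y z) (i<j⇒0<j-i
    (square-cancel-< {+ 2 * x + + 2 * y} (0≤* {+ 3} (+≤+ ℕ.z≤n) 0≤z)
      (<-by (z * z + + 4 * ((x - y) * (x - y))) (0<+ (0<* 0<z 0<z) (0≤* {+ 4} (+≤+ ℕ.z≤n) (0≤i*i (x - y))))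
        (trans (z′>0-eq x y z) (+0* (+ 8) zero-form)))))

  -- The drop is 2 (x + y - z), positive by the triangle inequality; the descent ends because of it.
  parent-z<z : z′ < z
  parent-z<z = <-by (+ 2 * (x + y - z)) (0<* 0<2 (i<j⇒0<j-i
    (square-cancel-< {z} (0≤+ (ℤ.<⇒≤ 0<x) 0≤y)
      (<-by (+ 2 * (x * y)) (0<* 0<2 (0<* 0<x 0<y)) (trans (sym (+0 zero-form)) (z′<z-eq x y z))))))
    (z-z′-eq x y z)

  -- Comparing squares, x′ < 0 gives 3 x > 4 y and y′ ≤ 0 gives 3 y ≥ 4 x; their sum contradicts
  -- positivity of the legs. So at most one sign change is ever needed.
  parent-signs : x′ < 0ℤ → 0ℤ < y′
  parent-signs x′<0 with 0ℤ ℤ.<? y′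
  ... | yes 0<y′ = 0<y′
  ... | no 0≮y′ = ⊥-elim (ℤ.<-asym (0<+ 0<x 0≤y) (0<j-i⇒i<j (subst (0ℤ <_) (sum-eq x y)
      (0<+ (0<*⇒0< 0<x (subst (0ℤ <_) (trans (sym (+0* (+ 4) zero-form)) (x′<0-eq x y z))
              (0<* (subst (0ℤ <_) (x′-eq x y z) (i<j⇒0<j-i x′<0))
                   (0<+ (0<* 0<2 0<z) (0≤+ (ℤ.<⇒≤ 0<x) (0≤* 0≤2 0≤y))))))
           (0≤*⇒0≤ 0<y (subst (0ℤ ≤_) (trans (sym (+0* (+ 4) zero-form)) (y′≤0-eq x y z))
              (0≤* (subst (0ℤ ≤_) (y′-eq x y z) (ℤ.i≤j⇒0≤j-i (ℤ.≮⇒≥ 0≮y′)))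
                   (0≤+ (0≤* 0≤2 0≤z) (0≤+ (0≤* 0≤2 (ℤ.<⇒≤ 0<x)) 0≤y)))))))))

  parent-core : Core x′ y′ z′
  parent-core = core-neg-z (core-B (core-neg-z isCore))

act-β⁻¹ : ∀ l t → act l (negate l (β⁻¹ t)) ≡ t
act-β⁻¹ l t = trans (cong β (negate-involutive l (β⁻¹ t))) (β∘β⁻¹ t)

parent : ∀ t → P t → Parent t
parent t@(x ∷ y ∷ z ∷ []) (p , 0<y)
  with ℤ.<-cmp 0ℤ (coord α (β⁻¹ t)) | 0ℤ ℤ.≤? coord γ (β⁻¹ t)
... | tri≈ _ 0≡x′ _ | _ = ⊥-elim (core-x≢0 (parent-core p 0<y) (sym 0≡x′))
... | tri< 0<x′ _ _ | yes 0≤y′ =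
  via-β (β⁻¹ t) (primitive₀ 0<x′ 0≤y′ (parent-0<z p 0<y) (parent-core p 0<y)) (parent-z<z p 0<y) (β∘β⁻¹ t)
... | tri< 0<x′ _ _ | no 0≰y′ =
  via-act α (negate α (β⁻¹ t))
    (primitive₀ 0<x′ (ℤ.<⇒≤ 0<-y′) (parent-0<z p 0<y) (core-neg-y (parent-core p 0<y)) , 0<-y′)
    (parent-z<z p 0<y) (act-β⁻¹ α t)
  where 0<-y′ = ℤ.neg-mono-< (ℤ.≰⇒> 0≰y′)
... | tri> _ _ x′<0 | _ =
  via-act γ (negate γ (β⁻¹ t))
    (primitive₀ (ℤ.neg-mono-< x′<0) (ℤ.<⇒≤ 0<y′) (parent-0<z p 0<y) (core-neg-x (parent-core p 0<y)) , 0<y′)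
    (parent-z<z p 0<y) (act-β⁻¹ γ t)
  where 0<y′ = parent-signs p 0<y x′<0

private
  -- The bound on the hypotenuse is the structurally decreasing argument of the descent.
  P⇒blocks-bounded : ∀ n t → hyp t ≤ + n → P t → ∃[ b ] ∃[ bs ] triple (b ∷ bs) ≡ t
  P⇒blocks-bounded zero t@(_ ∷ _ ∷ _ ∷ []) z≤0 (p , _) = ⊥-elim (ℤ.<⇒≱ (Primitive₀.0<z p) z≤0)
  P⇒blocks-bounded (suc n) t z≤1+n p with parent t p
  ... | via-act l s s∈P s<t refl with P⇒blocks-bounded n s (ℤ.i<j⇒i≤pred[j] (ℤ.<-≤-trans s<t z≤1+n)) s∈P
  ...   | b , bs , refl = l ∷ b , bs , refl
  P⇒blocks-bounded (suc n) t z≤1+n p | via-β s s∈P₀ s<t refl with P₀⇒P⊎e s s∈P₀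
  ...   | inj₂ refl = [] , [] , refl
  ...   | inj₁ s∈P with P⇒blocks-bounded n s (ℤ.i<j⇒i≤pred[j] (ℤ.<-≤-trans s<t z≤1+n)) s∈P
  ...     | b , bs , refl = [] , b ∷ bs , refl

P⇒blocks : ∀ t → P t → ∃[ b ] ∃[ bs ] triple (b ∷ bs) ≡ t
P⇒blocks t@(_ ∷ _ ∷ _ ∷ []) p@(p₀ , _) =
  P⇒blocks-bounded ∣ hyp t ∣ t (ℤ.≤-reflexive (sym (ℤ.0≤i⇒+∣i∣≡i (ℤ.<⇒≤ (Primitive₀.0<z p₀))))) p

-- Good blocks

-- Some pairs `l`, `other l`, and then either a final `l` or `l l` followed by anything: the first
-- blocks that the families of `H` allow.
data Good (l : Letter) : Block → Set where
  single : Good l (l ∷ [])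
  double : ∀ {b} → Good l (l ∷ l ∷ b)
  alternate : ∀ {b} → Good l b → Good l (l ∷ other l ∷ b)

private
  β-x-eq : ∀ x y z → + 2 * y + z ≡ + 2 * (x + + 2 * y + + 2 * z) - (+ 2 * x + + 2 * y + + 3 * z)
  β-x-eq = solve-∀
  β-y-eq : ∀ x y z → + 2 * x + z ≡ + 2 * (+ 2 * x + y + + 2 * z) - (+ 2 * x + + 2 * y + + 3 * z)
  β-y-eq = solve-∀
  γ-x-eq : ∀ x y z → + 2 * y + z ≡ + 2 * (- x + + 2 * y + + 2 * z) - (+ 2 * - x + + 2 * y + + 3 * z)
  γ-x-eq = solve-∀
  α-y-eq : ∀ x y z → + 2 * x + z ≡ + 2 * (+ 2 * x + - y + + 2 * z) - (+ 2 * x + + 2 * - y + + 3 * z)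
  α-y-eq = solve-∀
  α-x-eq : ∀ x y z → (+ 2 * x + + 2 * - y + + 3 * z) - + 2 * (x + + 2 * - y + + 2 * z) ≡ + 2 * y - z
  α-x-eq = solve-∀
  γ-y-eq : ∀ x y z → (+ 2 * - x + + 2 * y + + 3 * z) - + 2 * (+ 2 * - x + y + + 2 * z) ≡ + 2 * x - z
  γ-y-eq = solve-∀
  swap-eq : ∀ i j k l → i - j ≡ k - l → j - i ≡ l - k
  swap-eq i j k l eq = trans (neg i j) (trans (cong -_ eq) (sym (neg k l)))
    where
    neg : ∀ i j → j - i ≡ - (i - j)
    neg = solve-∀

Short Long : Letter → Triple → Set
Short l t = + 2 * coord l t < hyp t
Long  l t = hyp t < + 2 * coord l t

long-β : ∀ l t → P₀ t → Long l (β t)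
long-β α (x ∷ y ∷ z ∷ []) t =
  <-by (+ 2 * y + z) (ℤ.+-mono-≤-< (0≤* 0≤2 0≤y) 0<z) (β-x-eq x y z)
  where open Primitive₀ t
long-β γ (x ∷ y ∷ z ∷ []) t =
  <-by (+ 2 * x + z) (0<+ (0<* 0<2 0<x) (ℤ.<⇒≤ 0<z)) (β-y-eq x y z)
  where open Primitive₀ t

-- So a leading `l` can make no leg short but `coord l`. The same fact settles a repeated letter:
-- the inner `l` makes `coord (other l)` long, which the outer one turns into a short `coord l`.
long-other : ∀ l t → P t → Long (other l) (act l t)
long-other α (x ∷ y ∷ z ∷ []) (t , 0<y) =
  <-by (+ 2 * x + z) (0<+ (0<* 0<2 0<x) (ℤ.<⇒≤ 0<z)) (α-y-eq x y z)
  where open Primitive₀ t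
long-other γ (x ∷ y ∷ z ∷ []) (t , 0<y) =
  <-by (+ 2 * y + z) (0<+ (0<* 0<2 0<y) (ℤ.<⇒≤ 0<z)) (γ-x-eq x y z)
  where open Primitive₀ t

short⇔long : ∀ l t → (Short l (act l t) → Long (other l) t) × (Long (other l) t → Short l (act l t))
short⇔long α (x ∷ y ∷ z ∷ []) = <⇔<-by (α-x-eq x y z)
short⇔long γ (x ∷ y ∷ z ∷ []) = <⇔<-by (γ-y-eq x y z)

long⇔short : ∀ l t → (Long l (act l t) → Short (other l) t) × (Short (other l) t → Long l (act l t))
long⇔short α (x ∷ y ∷ z ∷ []) = <⇔<-by (swap-eq _ (+ 2 * (x + + 2 * - y + + 2 * z)) (+ 2 * y) z (α-x-eq x y z))
long⇔short γ (x ∷ y ∷ z ∷ []) = <⇔<-by (swap-eq _ (+ 2 * (+ 2 * - x + y + + 2 * z)) (+ 2 * x) z (γ-y-eq x y z))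

alternate-short : ∀ l t → (Short l (act l (act (other l) t)) → Short l t) × (Short l t → Short l (act l (act (other l) t)))
alternate-short α t =
  (proj₁ (long⇔short γ t) ∘ proj₁ (short⇔long α (act γ t))) , (proj₂ (short⇔long α (act γ t)) ∘ proj₂ (long⇔short γ t))
alternate-short γ t =
  (proj₁ (long⇔short α t) ∘ proj₁ (short⇔long γ (act α t))) , (proj₂ (short⇔long γ (act α t)) ∘ proj₂ (long⇔short α t))

good⇒short : ∀ {l b} t → P₀ t → Good l b → Short l (block b t)
good⇒short {l} t t∈ single = proj₂ (short⇔long l (β t)) (long-β (other l) t t∈)
good⇒short {l} t t∈ (double {b}) =
  proj₂ (short⇔long l (act l (block b t))) (long-other l (block b t) (block-P b t t∈))
good⇒short {l} t t∈ (alternate {b} g) = proj₂ (alternate-short l (block b t)) (good⇒short t t∈ g)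

short⇒good : ∀ l b t → P₀ t → Short l (block b t) → Good l b
short⇒good l [] t t∈ s = ⊥-elim (ℤ.<-asym s (long-β l t t∈))
short⇒good α (γ ∷ b) t t∈ s = ⊥-elim (ℤ.<-asym s (long-other γ (block b t) (block-P b t t∈)))
short⇒good γ (α ∷ b) t t∈ s = ⊥-elim (ℤ.<-asym s (long-other α (block b t) (block-P b t t∈)))
short⇒good α (α ∷ []) t t∈ s = single
short⇒good γ (γ ∷ []) t t∈ s = single
short⇒good α (α ∷ α ∷ b) t t∈ s = double
short⇒good γ (γ ∷ γ ∷ b) t t∈ s = double
short⇒good α (α ∷ γ ∷ b) t t∈ s = alternate (short⇒good α b t t∈ (proj₁ (alternate-short α (block b t)) s))
short⇒good γ (γ ∷ α ∷ b) t t∈ s = alternate (short⇒good γ b t t∈ (proj₁ (alternate-short γ (block b t)) s))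

good? : ∀ l b → Dec (Good l b)
good? l [] = no λ ()
good? α (γ ∷ b) = no λ ()
good? γ (α ∷ b) = no λ ()
good? α (α ∷ []) = yes single
good? γ (γ ∷ []) = yes single
good? α (α ∷ α ∷ b) = yes double
good? γ (γ ∷ γ ∷ b) = yes double
good? α (α ∷ γ ∷ b) with good? α b
... | yes g = yes (alternate g)
... | no ¬g = no λ { (alternate g) → ¬g g }
good? γ (γ ∷ α ∷ b) with good? γ b
... | yes g = yes (alternate g)
... | no ¬g = no λ { (alternate g) → ¬g g }

IsGood : Block → Set
IsGood b = ∃[ l ] Good l b

isGood? : ∀ b → Dec (IsGood b)
isGood? b with good? α b | good? γ b
... | yes g | _ = yes (α , g)
... | no _ | yes g = yes (γ , g)
... | no ¬α | no ¬γ = no λ { (α , g) → ¬α g ; (γ , g) → ¬γ g }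

-- Admissible block lists and the triples of 𝒫

data Admissible : List Block → Set where
  []  : Admissible []
  _∷_ : ∀ {b} → IsGood b → ∀ bs → Admissible (b ∷ bs)

𝔓⇒P : ∀ t → 𝔓 t → P t
𝔓⇒P (x ∷ y ∷ z ∷ []) (0<x , 0<y , 0<z , 2∣y , gcd≡1 , pyth) =
  primitive₀ 0<x (ℤ.<⇒≤ 0<y) 0<z (core (∣ᵤ⇒∣ 2∣y)
    (λ {d} p q r → ∣ᵤ⇒∣ (subst (d Unsigned.∣_) gcd≡1
      (gcd-greatest {gcd x y} {z} {d} (gcd-greatest {x} {y} {d} (∣⇒∣ᵤ p) (∣⇒∣ᵤ q)) (∣⇒∣ᵤ r))))
    pyth) , 0<y

P⇒𝔓 : ∀ t → P t → 𝔓 t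
P⇒𝔓 (x ∷ y ∷ z ∷ []) (t , 0<y) =
  0<x , 0<y , 0<z , ∣⇒∣ᵤ even ,
  cong +_ (ℕ.∣1⇒≡1 (∣⇒∣ᵤ (coprime {gcd (gcd x y) z}
    (∣ᵤ⇒∣ (ℕ.∣-trans (gcd[i,j]∣i (gcd x y) z) (gcd[i,j]∣i x y)))
    (∣ᵤ⇒∣ (ℕ.∣-trans (gcd[i,j]∣i (gcd x y) z) (gcd[i,j]∣j x y)))
    (∣ᵤ⇒∣ (gcd[i,j]∣j (gcd x y) z))))) ,
  pythagorean
  where open Primitive₀ t

minBelowHalf⇒short : ∀ t → MinBelowHalf t → ∃[ l ] Short l t
minBelowHalf⇒short (x ∷ y ∷ z ∷ []) m with ℤ.⊓-sel x y
... | inj₁ eq = α , subst (λ m → + 2 * m < z) eq m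
... | inj₂ eq = γ , subst (λ m → + 2 * m < z) eq m

short⇒minBelowHalf : ∀ l t → Short l t → MinBelowHalf t
short⇒minBelowHalf α (x ∷ y ∷ z ∷ []) s = ℤ.≤-<-trans (ℤ.*-monoˡ-≤-nonNeg (+ 2) (ℤ.i⊓j≤i x y)) s
short⇒minBelowHalf γ (x ∷ y ∷ z ∷ []) s = ℤ.≤-<-trans (ℤ.*-monoˡ-≤-nonNeg (+ 2) (ℤ.i⊓j≤j x y)) s

admissible⇒𝒫 : ∀ {bs} → Admissible bs → 𝒫 (triple bs)
admissible⇒𝒫 [] = inj₂ refl
admissible⇒𝒫 (_∷_ {b} (l , g) bs) = inj₁
  ( P⇒𝔓 (triple (b ∷ bs)) (triple-P b bs)
  , short⇒minBelowHalf l (triple (b ∷ bs)) (good⇒short (triple bs) (triple-P₀ bs) g))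

𝒫⇒admissible : ∀ t → 𝒫 t → ∃[ bs ] Admissible bs × triple bs ≡ t
𝒫⇒admissible t (inj₂ refl) = [] , [] , refl
𝒫⇒admissible t (inj₁ (t∈𝔓 , m)) with P⇒blocks t (𝔓⇒P t t∈𝔓) | minBelowHalf⇒short t m
... | b , bs , refl | l , s = b ∷ bs , (l , short⇒good l b (triple bs) (triple-P₀ bs) s) ∷ bs , refl

-- Matrix algebra and the matrices of block lists

private
  dot-assoc : ∀ a b c m₁₁ m₁₂ m₁₃ m₂₁ m₂₂ m₂₃ m₃₁ m₃₂ m₃₃ x y z →
    (a * m₁₁ + (b * m₂₁ + (c * m₃₁ + 0ℤ))) * x +
    ((a * m₁₂ + (b * m₂₂ + (c * m₃₂ + 0ℤ))) * y +
    ((a * m₁₃ + (b * m₂₃ + (c * m₃₃ + 0ℤ))) * z + 0ℤ)) ≡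
    a * (m₁₁ * x + (m₁₂ * y + (m₁₃ * z + 0ℤ))) +
    (b * (m₂₁ * x + (m₂₂ * y + (m₂₃ * z + 0ℤ))) +
    (c * (m₃₁ * x + (m₃₂ * y + (m₃₃ * z + 0ℤ))) + 0ℤ))
  dot-assoc = solve-∀

  vec₃ : ∀ {A : Set} {x y z x′ y′ z′ : A} → x ≡ x′ → y ≡ y′ → z ≡ z′ →
         _≡_ {A = Vec A 3} (x ∷ y ∷ z ∷ []) (x′ ∷ y′ ∷ z′ ∷ [])
  vec₃ refl refl refl = refl

  infixl 7 _ᵥ*_
  -- By definition `M · N` maps `_ᵥ* N` over the rows of `M`, so the matrix laws reduce to laws for
  -- a single row.
  _ᵥ*_ : Triple → Mat → Triple
  v ᵥ* M = Vec.map (dot v) (Vec.transpose M)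

  dot-*ᵥ : ∀ v M w → dot (v ᵥ* M) w ≡ dot v (M *ᵥ w)
  dot-*ᵥ (a ∷ b ∷ c ∷ [])
    ((m₁₁ ∷ m₁₂ ∷ m₁₃ ∷ []) ∷ (m₂₁ ∷ m₂₂ ∷ m₂₃ ∷ []) ∷ (m₃₁ ∷ m₃₂ ∷ m₃₃ ∷ []) ∷ []) (x ∷ y ∷ z ∷ []) =
    dot-assoc a b c m₁₁ m₁₂ m₁₃ m₂₁ m₂₂ m₂₃ m₃₁ m₃₂ m₃₃ x y z

  transpose-· : ∀ M N → Vec.transpose (M · N) ≡ Vec.map (M *ᵥ_) (Vec.transpose N)
  transpose-· ((_ ∷ _ ∷ _ ∷ []) ∷ (_ ∷ _ ∷ _ ∷ []) ∷ (_ ∷ _ ∷ _ ∷ []) ∷ [])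
              ((_ ∷ _ ∷ _ ∷ []) ∷ (_ ∷ _ ∷ _ ∷ []) ∷ (_ ∷ _ ∷ _ ∷ []) ∷ []) = refl

  ᵥ*-assoc : ∀ v M N → (v ᵥ* M) ᵥ* N ≡ v ᵥ* (M · N)
  ᵥ*-assoc v M N = trans (map-cong (dot-*ᵥ v M) (Vec.transpose N))
    (trans (map-∘ (dot v) (M *ᵥ_) (Vec.transpose N)) (cong (Vec.map (dot v)) (sym (transpose-· M N))))

  dot-e₁ : ∀ x y z → x * 1ℤ + (y * 0ℤ + (z * 0ℤ + 0ℤ)) ≡ x
  dot-e₁ = solve-∀
  dot-e₂ : ∀ x y z → x * 0ℤ + (y * 1ℤ + (z * 0ℤ + 0ℤ)) ≡ y
  dot-e₂ = solve-∀
  dot-e₃ : ∀ x y z → x * 0ℤ + (y * 0ℤ + (z * 1ℤ + 0ℤ)) ≡ z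
  dot-e₃ = solve-∀
  e₁-dot : ∀ x y z → 1ℤ * x + (0ℤ * y + (0ℤ * z + 0ℤ)) ≡ x
  e₁-dot = solve-∀
  e₂-dot : ∀ x y z → 0ℤ * x + (1ℤ * y + (0ℤ * z + 0ℤ)) ≡ y
  e₂-dot = solve-∀
  e₃-dot : ∀ x y z → 0ℤ * x + (0ℤ * y + (1ℤ * z + 0ℤ)) ≡ z
  e₃-dot = solve-∀

  ᵥ*-identityʳ : ∀ v → v ᵥ* I₃ ≡ v
  ᵥ*-identityʳ (x ∷ y ∷ z ∷ []) = vec₃ (dot-e₁ x y z) (dot-e₂ x y z) (dot-e₃ x y z)

·-assoc : ∀ L M N → (L · M) · N ≡ L · (M · N)
·-assoc L M N = trans (sym (map-∘ (_ᵥ* N) (_ᵥ* M) L)) (map-cong (λ v → ᵥ*-assoc v M N) L)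

*ᵥ-assoc : ∀ M N v → (M · N) *ᵥ v ≡ M *ᵥ N *ᵥ v
*ᵥ-assoc M N v = trans (sym (map-∘ (λ w → dot w v) (_ᵥ* N) M)) (map-cong (λ w → dot-*ᵥ w N v) M)

·-identityʳ : ∀ M → M · I₃ ≡ M
·-identityʳ M = trans (map-cong ᵥ*-identityʳ M) (map-id M)

·-identityˡ : ∀ M → I₃ · M ≡ M
·-identityˡ ((m₁₁ ∷ m₁₂ ∷ m₁₃ ∷ []) ∷ (m₂₁ ∷ m₂₂ ∷ m₂₃ ∷ []) ∷ (m₃₁ ∷ m₃₂ ∷ m₃₃ ∷ []) ∷ []) = vec₃
  (vec₃ (e₁-dot m₁₁ m₂₁ m₃₁) (e₁-dot m₁₂ m₂₂ m₃₂) (e₁-dot m₁₃ m₂₃ m₃₃))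
  (vec₃ (e₂-dot m₁₁ m₂₁ m₃₁) (e₂-dot m₁₂ m₂₂ m₃₂) (e₂-dot m₁₃ m₂₃ m₃₃))
  (vec₃ (e₃-dot m₁₁ m₂₁ m₃₁) (e₃-dot m₁₂ m₂₂ m₃₂) (e₃-dot m₁₃ m₂₃ m₃₃))

letterMat : Letter → Mat
letterMat α = mA
letterMat γ = mC

blockMat : Block → Mat
blockMat []      = mB
blockMat (l ∷ b) = letterMat l · blockMat b

mat : List Block → Mat
mat []       = I₃
mat (b ∷ bs) = blockMat b · mat bs

private
  row₁₂₂ : ∀ x y z → + 1 * x + (+ 2 * y + (+ 2 * z + 0ℤ)) ≡ x + + 2 * y + + 2 * z
  row₁₂₂ = solve-∀
  row₂₁₂ : ∀ x y z → + 2 * x + (+ 1 * y + (+ 2 * z + 0ℤ)) ≡ + 2 * x + y + + 2 * z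
  row₂₁₂ = solve-∀
  row₂₂₃ : ∀ x y z → + 2 * x + (+ 2 * y + (+ 3 * z + 0ℤ)) ≡ + 2 * x + + 2 * y + + 3 * z
  row₂₂₃ = solve-∀
  rowA₁ : ∀ x y z → + 1 * x + (- + 2 * y + (+ 2 * z + 0ℤ)) ≡ x + + 2 * - y + + 2 * z
  rowA₁ = solve-∀
  rowA₂ : ∀ x y z → + 2 * x + (- + 1 * y + (+ 2 * z + 0ℤ)) ≡ + 2 * x + - y + + 2 * z
  rowA₂ = solve-∀
  rowA₃ : ∀ x y z → + 2 * x + (- + 2 * y + (+ 3 * z + 0ℤ)) ≡ + 2 * x + + 2 * - y + + 3 * z
  rowA₃ = solve-∀
  rowC₁ : ∀ x y z → - + 1 * x + (+ 2 * y + (+ 2 * z + 0ℤ)) ≡ - x + + 2 * y + + 2 * z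
  rowC₁ = solve-∀
  rowC₂ : ∀ x y z → - + 2 * x + (+ 1 * y + (+ 2 * z + 0ℤ)) ≡ + 2 * - x + y + + 2 * z
  rowC₂ = solve-∀
  rowC₃ : ∀ x y z → - + 2 * x + (+ 2 * y + (+ 3 * z + 0ℤ)) ≡ + 2 * - x + + 2 * y + + 3 * z
  rowC₃ = solve-∀

mB*ᵥ : ∀ t → mB *ᵥ t ≡ β t
mB*ᵥ (x ∷ y ∷ z ∷ []) = vec₃ (row₁₂₂ x y z) (row₂₁₂ x y z) (row₂₂₃ x y z)

letterMat*ᵥ : ∀ l t → letterMat l *ᵥ t ≡ act l t
letterMat*ᵥ α (x ∷ y ∷ z ∷ []) = vec₃ (rowA₁ x y z) (rowA₂ x y z) (rowA₃ x y z)
letterMat*ᵥ γ (x ∷ y ∷ z ∷ []) = vec₃ (rowC₁ x y z) (rowC₂ x y z) (rowC₃ x y z)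

blockMat*ᵥ : ∀ b t → blockMat b *ᵥ t ≡ block b t
blockMat*ᵥ [] t = mB*ᵥ t
blockMat*ᵥ (l ∷ b) t = trans (*ᵥ-assoc (letterMat l) (blockMat b) t)
  (trans (cong (letterMat l *ᵥ_) (blockMat*ᵥ b t)) (letterMat*ᵥ l (block b t)))

mat*ᵥe : ∀ bs → mat bs *ᵥ e ≡ triple bs
mat*ᵥe [] = refl
mat*ᵥe (b ∷ bs) = trans (*ᵥ-assoc (blockMat b) (mat bs) e)
  (trans (cong (blockMat b *ᵥ_) (mat*ᵥe bs)) (blockMat*ᵥ b (triple bs)))

-- No entries are compared: the image of `e` already determines the word.
mat-injective : ∀ bs cs → mat bs ≡ mat cs → bs ≡ cs
mat-injective bs cs eq = triple-injective bs cs
  (trans (sym (mat*ᵥe bs)) (trans (cong (_*ᵥ e) eq) (mat*ᵥe cs)))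

mat-++ : ∀ bs cs → mat (bs ++ cs) ≡ mat bs · mat cs
mat-++ [] cs = sym (·-identityˡ (mat cs))
mat-++ (b ∷ bs) cs = trans (cong (blockMat b ·_) (mat-++ bs cs)) (sym (·-assoc (blockMat b) (mat bs) (mat cs)))

letterMat∈G : ∀ l → G (letterMat l)
letterMat∈G α = A∈G
letterMat∈G γ = C∈G

blockMat∈G : ∀ b → G (blockMat b)
blockMat∈G []      = B∈G
blockMat∈G (l ∷ b) = ·∈G (letterMat∈G l) (blockMat∈G b)

mat∈G : ∀ bs → G (mat bs)
mat∈G []       = I∈G
mat∈G (b ∷ bs) = ·∈G (blockMat∈G b) (mat∈G bs)

EndsInB : Mat → Set
EndsInB M = ∃[ b ] ∃[ bs ] mat (b ∷ bs) ≡ M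

letter·-endsInB : ∀ l b bs → mat ((l ∷ b) ∷ bs) ≡ letterMat l · mat (b ∷ bs)
letter·-endsInB l b bs = ·-assoc (letterMat l) (blockMat b) (mat bs)

-- An element of `G` need not be a list of blocks by itself; a right factor ending in B completes
-- its last block. Hence `M` is arbitrary, and a product is absorbed right factor first.
G·-endsInB : ∀ {N M} → G N → EndsInB M → EndsInB (N · M)
G·-endsInB I∈G (b , bs , refl) = b , bs , sym (·-identityˡ _)
G·-endsInB A∈G (b , bs , refl) = α ∷ b , bs , letter·-endsInB α b bs
G·-endsInB B∈G (b , bs , refl) = [] , b ∷ bs , refl
G·-endsInB C∈G (b , bs , refl) = γ ∷ b , bs , letter·-endsInB γ b bs
G·-endsInB {M = K} (·∈G {M} {N} p q) r with G·-endsInB p (G·-endsInB q r)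
... | b , bs , eq = b , bs , trans eq (sym (·-assoc M N K))

mB-endsInB : EndsInB mB
mB-endsInB = [] , [] , refl

blockMat-split : ∀ b → ∃[ N ] G N × blockMat b ≡ N · mB
blockMat-split [] = I₃ , I∈G , refl
blockMat-split (l ∷ b) with blockMat-split b
... | N , N∈G , eq = letterMat l · N , ·∈G (letterMat∈G l) N∈G ,
  trans (cong (letterMat l ·_) eq) (sym (·-assoc (letterMat l) N mB))

endsInB-split : ∀ b bs → ∃[ N ] G N × mat (b ∷ bs) ≡ N · mB
endsInB-split b [] with blockMat-split b
... | N , N∈G , eq = N , N∈G , trans (·-identityʳ (blockMat b)) eq
endsInB-split b (c ∷ cs) with endsInB-split c cs
... | N , N∈G , eq = blockMat b · N , ·∈G (blockMat∈G b) N∈G ,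
  trans (cong (blockMat b ·_) eq) (sym (·-assoc (blockMat b) N mB))

-- The families of `H` as matrices with a good first block

alternation : Letter → Mat
alternation l = letterMat l · letterMat (other l)

-- The tail that remains after a power of `alternation l`. Exponent 0 gives the families without
-- such a power; of A^k B only k = 1 needs `single₀`, since larger k are instances of A² N B, and
-- likewise for C.
data CoreForm (l : Letter) : Mat → Set where
  doubleN : ∀ {N} → G N → CoreForm l (letterMat l · (letterMat l · (N · mB)))
  singleN : ∀ {N} → G N → CoreForm l (letterMat l · (mB · (N · mB)))
  single₀ : CoreForm l (letterMat l · mB)

StartsGood : Letter → Mat → Set
StartsGood l M = ∃[ b ] ∃[ bs ] Good l b × mat (b ∷ bs) ≡ M

core-form⇒startsGood : ∀ {l M} → CoreForm l M → StartsGood l M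
core-form⇒startsGood {l} (doubleN N∈G) with G·-endsInB N∈G mB-endsInB
... | b , bs , eq = l ∷ l ∷ b , bs , double ,
  trans (letter·-endsInB l (l ∷ b) bs) (cong (letterMat l ·_) (trans (letter·-endsInB l b bs) (cong (letterMat l ·_) eq)))
core-form⇒startsGood {l} (singleN N∈G) with G·-endsInB N∈G mB-endsInB
... | b , bs , eq = l ∷ [] , b ∷ bs , single ,
  trans (letter·-endsInB l [] (b ∷ bs)) (cong (λ M → letterMat l · (mB · M)) eq)
core-form⇒startsGood {l} single₀ = l ∷ [] , [] , single , ·-identityʳ (letterMat l · mB)

alternation·-startsGood : ∀ {l M} k → StartsGood l M → StartsGood l (alternation l ^ k · M)
alternation·-startsGood zero (b , bs , g , refl) = b , bs , g , sym (·-identityˡ _)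
alternation·-startsGood {l} {M} (suc k) s with alternation·-startsGood k s
... | b , bs , g , eq = l ∷ other l ∷ b , bs , alternate g ,
  trans (letter·-endsInB l (other l ∷ b) bs)
  (trans (cong (letterMat l ·_) (trans (letter·-endsInB (other l) b bs) (cong (letterMat (other l) ·_) eq)))
  (trans (sym (·-assoc (letterMat l) (letterMat (other l)) (alternation l ^ k · M)))
         (sym (·-assoc (alternation l) (alternation l ^ k) M))))

startsGood⇒core-form : ∀ {l b} bs → Good l b →
  ∃[ k ] ∃[ M ] CoreForm l M × mat (b ∷ bs) ≡ alternation l ^ k · M
startsGood⇒core-form {l} [] single = 0 , _ , single₀ , trans (·-identityʳ _) (sym (·-identityˡ _))
startsGood⇒core-form {l} (b ∷ bs) single with endsInB-split b bs
... | N , N∈G , eq = 0 , _ , singleN N∈G ,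
  trans (letter·-endsInB l [] (b ∷ bs)) (trans (cong (λ M → letterMat l · (mB · M)) eq) (sym (·-identityˡ _)))
startsGood⇒core-form {l} bs (double {b}) with endsInB-split b bs
... | N , N∈G , eq = 0 , _ , doubleN N∈G ,
  trans (letter·-endsInB l (l ∷ b) bs)
  (trans (cong (letterMat l ·_) (trans (letter·-endsInB l b bs) (cong (letterMat l ·_) eq))) (sym (·-identityˡ _)))
startsGood⇒core-form {l} bs (alternate {b} g) with startsGood⇒core-form bs g
... | k , M , f , eq = suc k , M , f ,
  trans (letter·-endsInB l (other l ∷ b) bs)
  (trans (cong (letterMat l ·_) (trans (letter·-endsInB (other l) b bs) (cong (letterMat (other l) ·_) eq)))
  (trans (sym (·-assoc (letterMat l) (letterMat (other l)) (alternation l ^ k · M)))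
         (sym (·-assoc (alternation l) (alternation l ^ k) M))))

private
  square : ∀ M → M ^ 2 ≡ M · M
  square M = cong (M ·_) (·-identityʳ M)

  assoc₄ : ∀ K L M N → K · L · M · N ≡ K · (L · (M · N))
  assoc₄ K L M N = trans (·-assoc (K · L) M N) (·-assoc K L (M · N))

  assoc₅ : ∀ J K L M N → J · K · L · M · N ≡ J · (K · (L · (M · N)))
  assoc₅ J K L M N = trans (·-assoc (J · K · L) M N) (assoc₄ J K L (M · N))

  square-assoc : ∀ M N K → M ^ 2 · N · K ≡ M · (M · (N · K))
  square-assoc M N K = trans (cong (λ L → L · N · K) (square M)) (assoc₄ M M N K)

  power-square-assoc : ∀ L M N K → L · M ^ 2 · N · K ≡ L · (M · (M · (N · K)))
  power-square-assoc L M N K = trans (assoc₄ L (M ^ 2) N K)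
    (cong (L ·_) (trans (sym (·-assoc (M ^ 2) N K)) (square-assoc M N K)))

core-form⇒H : ∀ l k {M} → CoreForm l M → H (alternation l ^ k · M)
core-form⇒H α zero (doubleN {N} p) = subst H (trans (square-assoc mA N mB) (sym (·-identityˡ _))) (A²NB p)
core-form⇒H γ zero (doubleN {N} p) = subst H (trans (square-assoc mC N mB) (sym (·-identityˡ _))) (C²NB p)
core-form⇒H α zero (singleN {N} p) = subst H (trans (assoc₄ mA mB N mB) (sym (·-identityˡ _))) (ABNB p)
core-form⇒H γ zero (singleN {N} p) = subst H (trans (assoc₄ mC mB N mB) (sym (·-identityˡ _))) (CBNB p)
-- Closed matrices: `mA ^ 1 · mB` and the goal agree by evaluation.
core-form⇒H α zero single₀ = AᵏB 1 (ℕ.s≤s ℕ.z≤n)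
core-form⇒H γ zero single₀ = CᵏB 1 (ℕ.s≤s ℕ.z≤n)
core-form⇒H α (suc k) (doubleN {N} p) =
  subst H (power-square-assoc (alternation α ^ suc k) mA N mB) ([AC]ᵏA²NB (suc k) (ℕ.s≤s ℕ.z≤n) p)
core-form⇒H γ (suc k) (doubleN {N} p) =
  subst H (power-square-assoc (alternation γ ^ suc k) mC N mB) ([CA]ᵏC²NB (suc k) (ℕ.s≤s ℕ.z≤n) p)
core-form⇒H α (suc k) (singleN {N} p) =
  subst H (assoc₅ (alternation α ^ suc k) mA mB N mB) ([AC]ᵏABNB (suc k) (ℕ.s≤s ℕ.z≤n) p)
core-form⇒H γ (suc k) (singleN {N} p) =
  subst H (assoc₅ (alternation γ ^ suc k) mC mB N mB) ([CA]ᵏCBNB (suc k) (ℕ.s≤s ℕ.z≤n) p)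
core-form⇒H α (suc k) single₀ =
  subst H (·-assoc (alternation α ^ suc k) mA mB) ([AC]ᵏAB (suc k) (ℕ.s≤s ℕ.z≤n))
core-form⇒H γ (suc k) single₀ =
  subst H (·-assoc (alternation γ ^ suc k) mC mB) ([CA]ᵏCB (suc k) (ℕ.s≤s ℕ.z≤n))

letterPower⇒startsGood : ∀ l k → StartsGood l (letterMat l ^ suc k · mB)
letterPower⇒startsGood l k = replicate (suc k) l , [] , good k , trans (·-identityʳ _) (power (suc k))
  where
  good : ∀ k → Good l (replicate (suc k) l)
  good zero    = single
  good (suc k) = double
  power : ∀ k → blockMat (replicate k l) ≡ letterMat l ^ k · mB
  power zero    = sym (·-identityˡ mB)
  power (suc k) = trans (cong (letterMat l ·_) (power k)) (sym (·-assoc (letterMat l) (letterMat l ^ k) mB))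

H⇒startsGood : ∀ {M} → H M → ∃[ l ] StartsGood l M
H⇒startsGood (A²NB {N} p) = α , subst (StartsGood α) (sym (square-assoc mA N mB)) (core-form⇒startsGood (doubleN p))
H⇒startsGood (AᵏB (suc k) _) = α , letterPower⇒startsGood α k
H⇒startsGood (ABNB {N} p) = α , subst (StartsGood α) (sym (assoc₄ mA mB N mB)) (core-form⇒startsGood (singleN p))
H⇒startsGood (C²NB {N} p) = γ , subst (StartsGood γ) (sym (square-assoc mC N mB)) (core-form⇒startsGood (doubleN p))
H⇒startsGood (CᵏB (suc k) _) = γ , letterPower⇒startsGood γ k
H⇒startsGood (CBNB {N} p) = γ , subst (StartsGood γ) (sym (assoc₄ mC mB N mB)) (core-form⇒startsGood (singleN p))
H⇒startsGood ([AC]ᵏA²NB k {N} _ p) = α , subst (StartsGood α) (sym (power-square-assoc (alternation α ^ k) mA N mB))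
  (alternation·-startsGood k (core-form⇒startsGood (doubleN p)))
H⇒startsGood ([AC]ᵏABNB k {N} _ p) = α , subst (StartsGood α) (sym (assoc₅ (alternation α ^ k) mA mB N mB))
  (alternation·-startsGood k (core-form⇒startsGood (singleN p)))
H⇒startsGood ([AC]ᵏAB k _) = α , subst (StartsGood α) (sym (·-assoc (alternation α ^ k) mA mB))
  (alternation·-startsGood k (core-form⇒startsGood single₀))
H⇒startsGood ([CA]ᵏC²NB k {N} _ p) = γ , subst (StartsGood γ) (sym (power-square-assoc (alternation γ ^ k) mC N mB))
  (alternation·-startsGood k (core-form⇒startsGood (doubleN p)))
H⇒startsGood ([CA]ᵏCBNB k {N} _ p) = γ , subst (StartsGood γ) (sym (assoc₅ (alternation γ ^ k) mC mB N mB))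
  (alternation·-startsGood k (core-form⇒startsGood (singleN p)))
H⇒startsGood ([CA]ᵏCB k _) = γ , subst (StartsGood γ) (sym (·-assoc (alternation γ ^ k) mC mB))
  (alternation·-startsGood k (core-form⇒startsGood single₀))

H′⇒admissible : ∀ {M} → H′ M → ∃[ bs ] Admissible bs × mat bs ≡ M
H′⇒admissible (inj₂ M≡I) = [] , [] , sym M≡I
H′⇒admissible (inj₁ M∈H) with H⇒startsGood M∈H
... | l , b , bs , g , eq = b ∷ bs , (l , g) ∷ bs , eq

admissible⇒H′ : ∀ {bs} → Admissible bs → H′ (mat bs)
admissible⇒H′ [] = inj₂ refl
admissible⇒H′ ((l , g) ∷ bs) with startsGood⇒core-form bs g
... | k , M , f , eq = inj₁ (subst H (sym eq) (core-form⇒H l k f))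

++-admissible : ∀ {bs cs} → Admissible bs → Admissible cs → Admissible (bs ++ cs)
++-admissible [] q = q
++-admissible {cs = cs} (g ∷ bs) q = g ∷ (bs ++ cs)

H′-closed : ∀ {M N} → H′ M → H′ N → H′ (M · N)
H′-closed p q with H′⇒admissible p | H′⇒admissible q
... | bs , ab , refl | cs , ac , refl = subst H′ (mat-++ bs cs) (admissible⇒H′ (++-admissible ab ac))

H′⊆G : ∀ {M} → H′ M → G M
H′⊆G p with H′⇒admissible p
... | bs , _ , refl = mat∈G bs

-- Sublattices of ℤ²

private
  lagrange-eq : ∀ x₁ x₂ y₁ y₂ →
    (x₁ * y₁ + x₂ * y₂) * (x₁ * y₁ + x₂ * y₂) + (x₁ * y₂ - x₂ * y₁) * (x₁ * y₂ - x₂ * y₁) ≡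
    (x₁ * x₁ + x₂ * x₂) * (y₁ * y₁ + y₂ * y₂)
  lagrange-eq = solve-∀
  norm-lin-eq : ∀ m n x₁ x₂ y₁ y₂ →
    (m * x₁ + n * y₁) * (m * x₁ + n * y₁) + (m * x₂ + n * y₂) * (m * x₂ + n * y₂) ≡
    m * m * (x₁ * x₁ + x₂ * x₂) + n * n * (y₁ * y₁ + y₂ * y₂) + + 2 * (m * n) * (x₁ * y₁ + x₂ * y₂)
  norm-lin-eq = solve-∀
  wedge-lin-eq : ∀ a b c d x₁ x₂ y₁ y₂ →
    (a * x₁ + b * y₁) * (c * x₂ + d * y₂) - (a * x₂ + b * y₂) * (c * x₁ + d * y₁) ≡
    (a * d - b * c) * (x₁ * y₂ - x₂ * y₁)
  wedge-lin-eq = solve-∀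
  cramer₁ : ∀ x₁ x₂ y₁ y₂ w₁ w₂ →
    (x₁ * y₂ - x₂ * y₁) * w₁ ≡ (w₁ * y₂ - w₂ * y₁) * x₁ + (x₁ * w₂ - x₂ * w₁) * y₁
  cramer₁ = solve-∀
  cramer₂ : ∀ x₁ x₂ y₁ y₂ w₁ w₂ →
    (x₁ * y₂ - x₂ * y₁) * w₂ ≡ (w₁ * y₂ - w₂ * y₁) * x₂ + (x₁ * w₂ - x₂ * w₁) * y₂
  cramer₂ = solve-∀
  lin-lin-eq : ∀ m n a b c d u v → m * (a * u + b * v) + n * (c * u + d * v) ≡ (m * a + n * c) * u + (m * b + n * d) * v
  lin-lin-eq = solve-∀
  norm-scale-eq : ∀ k x₁ x₂ → k * x₁ * (k * x₁) + k * x₂ * (k * x₂) ≡ k * k * (x₁ * x₁ + x₂ * x₂)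
  norm-scale-eq = solve-∀
  wedge-add-eq : ∀ m x₁ x₂ y₁ y₂ u₁ u₂ → (m * x₁ + y₁) * u₂ - (m * x₂ + y₂) * u₁ ≡
    m * (x₁ * u₂ - x₂ * u₁) + (y₁ * u₂ - y₂ * u₁)
  wedge-add-eq = solve-∀
  wedge-scale-eq : ∀ m x₁ x₂ u₁ u₂ → m * x₁ * u₂ - m * x₂ * u₁ ≡ m * (x₁ * u₂ - x₂ * u₁)
  wedge-scale-eq = solve-∀

pair-ext : ∀ {x y : ℤ²} → proj₁ x ≡ proj₁ y → proj₂ x ≡ proj₂ y → x ≡ y
pair-ext refl refl = refl

lagrange : ∀ x y → ⟨ x , y ⟩ * ⟨ x , y ⟩ + (x ∧ y) * (x ∧ y) ≡ ‖ x ‖² * ‖ y ‖²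
lagrange (x₁ , x₂) (y₁ , y₂) = lagrange-eq x₁ x₂ y₁ y₂

norm-lin : ∀ m n x y → ‖ m • x ⊕ n • y ‖² ≡ m * m * ‖ x ‖² + n * n * ‖ y ‖² + + 2 * (m * n) * ⟨ x , y ⟩
norm-lin m n (x₁ , x₂) (y₁ , y₂) = norm-lin-eq m n x₁ x₂ y₁ y₂

wedge-lin : ∀ a b c d x y → (a • x ⊕ b • y) ∧ (c • x ⊕ d • y) ≡ (a * d - b * c) * (x ∧ y)
wedge-lin a b c d (x₁ , x₂) (y₁ , y₂) = wedge-lin-eq a b c d x₁ x₂ y₁ y₂

cramer : ∀ x y w → (x ∧ y) • w ≡ (w ∧ y) • x ⊕ (x ∧ w) • y
cramer (x₁ , x₂) (y₁ , y₂) (w₁ , w₂) = pair-ext (cramer₁ x₁ x₂ y₁ y₂ w₁ w₂) (cramer₂ x₁ x₂ y₁ y₂ w₁ w₂)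

lin-lin : ∀ m n a b c d u v →
  m • (a • u ⊕ b • v) ⊕ n • (c • u ⊕ d • v) ≡ (m * a + n * c) • u ⊕ (m * b + n * d) • v
lin-lin m n a b c d (u₁ , u₂) (v₁ , v₂) = pair-ext (lin-lin-eq m n a b c d u₁ v₁) (lin-lin-eq m n a b c d u₂ v₂)

norm-scale : ∀ k x → ‖ k • x ‖² ≡ k * k * ‖ x ‖²
norm-scale k (x₁ , x₂) = norm-scale-eq k x₁ x₂

wedge-add : ∀ m x y u → (m • x ⊕ y) ∧ u ≡ m * (x ∧ u) + (y ∧ u)
wedge-add m (x₁ , x₂) (y₁ , y₂) (u₁ , u₂) = wedge-add-eq m x₁ x₂ y₁ y₂ u₁ u₂

wedge-scale : ∀ m x u → (m • x) ∧ u ≡ m * (x ∧ u)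
wedge-scale m (x₁ , x₂) (u₁ , u₂) = wedge-scale-eq m x₁ x₂ u₁ u₂

0≤norm : ∀ x → 0ℤ ≤ ‖ x ‖²
0≤norm (x₁ , x₂) = 0≤+ (0≤i*i x₁) (0≤i*i x₂)

i*i≡0⇒i≡0 : ∀ i → i * i ≡ 0ℤ → i ≡ 0ℤ
i*i≡0⇒i≡0 i eq with ℤ.i*j≡0⇒i≡0∨j≡0 i eq
... | inj₁ p = p
... | inj₂ p = p

i+j≡0⇒i≡0 : ∀ {i j} → 0ℤ ≤ i → 0ℤ ≤ j → i + j ≡ 0ℤ → i ≡ 0ℤ
i+j≡0⇒i≡0 {i} {j} 0≤i 0≤j eq = ℤ.≤-antisym
  (subst₂ _≤_ (ℤ.+-identityʳ i) eq (ℤ.+-monoʳ-≤ i 0≤j)) 0≤i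

norm≡0⇒≡𝟎 : ∀ x → ‖ x ‖² ≡ 0ℤ → x ≡ 𝟎
norm≡0⇒≡𝟎 (x₁ , x₂) eq = pair-ext
  (i*i≡0⇒i≡0 x₁ (i+j≡0⇒i≡0 (0≤i*i x₁) (0≤i*i x₂) eq))
  (i*i≡0⇒i≡0 x₂ (i+j≡0⇒i≡0 (0≤i*i x₂) (0≤i*i x₁) (trans (ℤ.+-comm (x₂ * x₂) _) eq)))

0<norm : ∀ {x} → x ≢ 𝟎 → 0ℤ < ‖ x ‖²
0<norm {x} x≢𝟎 = ℤ.≤∧≢⇒< (0≤norm x) (x≢𝟎 ∘ norm≡0⇒≡𝟎 x ∘ sym)

i≢0⇒0<i*i : ∀ {i} → i ≢ 0ℤ → 0ℤ < i * i
i≢0⇒0<i*i {i} i≢0 = ℤ.≤∧≢⇒< (0≤i*i i) (i≢0 ∘ i*i≡0⇒i≡0 i ∘ sym)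

≡𝟎? : ∀ x → Dec (x ≡ 𝟎)
≡𝟎? (x₁ , x₂) with x₁ ℤ.≟ 0ℤ | x₂ ℤ.≟ 0ℤ
... | yes refl | yes refl = yes refl
... | no x₁≢0 | _ = no (x₁≢0 ∘ cong proj₁)
... | yes _ | no x₂≢0 = no (x₂≢0 ∘ cong proj₂)

*≡0 : ∀ {i j} → i ≢ 0ℤ → i * j ≡ 0ℤ → j ≡ 0ℤ
*≡0 {i} i≢0 eq with ℤ.i*j≡0⇒i≡0∨j≡0 i eq
... | inj₁ p = ⊥-elim (i≢0 p)
... | inj₂ p = p

•≡𝟎 : ∀ {k} x → k ≢ 0ℤ → k • x ≡ 𝟎 → x ≡ 𝟎
•≡𝟎 (x₁ , x₂) k≢0 eq = pair-ext (*≡0 k≢0 (cong proj₁ eq)) (*≡0 k≢0 (cong proj₂ eq))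

private
  ind₁ : ∀ x y → y * x + - x * y ≡ 0ℤ
  ind₁ = solve-∀
  ind₂ : ∀ x₁ x₂ y₁ y₂ → y₁ * x₂ + - x₁ * y₂ ≡ - (x₁ * y₂ - x₂ * y₁)
  ind₂ = solve-∀
  ind₃ : ∀ x₁ x₂ y₁ y₂ → y₂ * x₁ + - x₂ * y₁ ≡ x₁ * y₂ - x₂ * y₁
  ind₃ = solve-∀
  wedge-y-eq : ∀ m n x₁ x₂ y₁ y₂ → m * (x₁ * y₂ - x₂ * y₁) ≡ (m * x₁ + n * y₁) * y₂ - (m * x₂ + n * y₂) * y₁
  wedge-y-eq = solve-∀
  wedge-x-eq : ∀ m n x₁ x₂ y₁ y₂ → n * (x₁ * y₂ - x₂ * y₁) ≡ x₁ * (m * x₂ + n * y₂) - x₂ * (m * x₁ + n * y₁)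
  wedge-x-eq = solve-∀
  0*-eq : ∀ x y → 0ℤ * y - 0ℤ * x ≡ 0ℤ
  0*-eq = solve-∀
  *0-eq : ∀ x y → x * 0ℤ - y * 0ℤ ≡ 0ℤ
  *0-eq = solve-∀

-- If the determinant vanished, `y₁ • x ⊕ - x₁ • y` and `y₂ • x ⊕ - x₂ • y` would be zero.
-- Independence would then make every coordinate 0, and `1ℤ • x` would be a nontrivial relation.
independent⇒wedge≢0 : ∀ x y → LinearlyIndependent x y → x ∧ y ≢ 0ℤ
independent⇒wedge≢0 (x₁ , x₂) (y₁ , y₂) ind x∧y≡0
  with ind y₁ (- x₁) (pair-ext (ind₁ x₁ y₁) (trans (ind₂ x₁ x₂ y₁ y₂) (cong -_ x∧y≡0)))
     | ind y₂ (- x₂) (pair-ext (trans (ind₃ x₁ x₂ y₁ y₂) x∧y≡0) (ind₁ x₂ y₂))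
... | refl , -x₁≡0 | refl , -x₂≡0 with ℤ.neg-injective {x₁} {0ℤ} -x₁≡0 | ℤ.neg-injective {x₂} {0ℤ} -x₂≡0
...   | refl | refl with proj₁ (ind 1ℤ 0ℤ refl)
...     | ()

wedge≢0⇒independent : ∀ x y → x ∧ y ≢ 0ℤ → LinearlyIndependent x y
wedge≢0⇒independent x@(x₁ , x₂) y@(y₁ , y₂) x∧y≢0 m n eq =
  *≡0 x∧y≢0 (trans (ℤ.*-comm (x ∧ y) m) (trans (wedge-y-eq m n x₁ x₂ y₁ y₂) (trans (cong (_∧ y) eq) (0*-eq y₁ y₂)))) ,
  *≡0 x∧y≢0 (trans (ℤ.*-comm (x ∧ y) n) (trans (wedge-x-eq m n x₁ x₂ y₁ y₂) (trans (cong (x ∧_) eq) (*0-eq x₁ x₂))))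

module _ (Λ : Sublattice) where

  ⟦⟧-lin : ∀ {x y} m n → x ∈ ⟦ Λ ⟧ → y ∈ ⟦ Λ ⟧ → m • x ⊕ n • y ∈ ⟦ Λ ⟧
  ⟦⟧-lin m n (a , b , refl) (c , d , refl) = m * a + n * c , m * b + n * d , lin-lin m n a b c d (b₁ Λ) (b₂ Λ)

private
  abs-square : ∀ i → + ∣ i ∣ * + ∣ i ∣ ≡ i * i
  abs-square i with ℤ.+∣i∣≡i⊎+∣i∣≡-i i
  ... | inj₁ eq = cong (λ j → j * j) eq
  ... | inj₂ eq = trans (cong (λ j → j * j) eq) (*-square-neg i)

  round-eq : ∀ q n r → r + q * n ≡ q * n + r
  round-eq = solve-∀
  round-eq′ : ∀ q n r → r + q * n ≡ (q + 1ℤ) * n + (r - n)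
  round-eq′ = solve-∀
  square-4-eq : ∀ n r → (n - + 2 * r) * (n + + 2 * r) ≡ n * n - + 4 * (r * r)
  square-4-eq = solve-∀
  square-4-eq′ : ∀ n r → (+ 2 * r - n) * (+ 2 * (n - r) + n) ≡ n * n - + 4 * ((r - n) * (r - n))
  square-4-eq′ = solve-∀
  neg-neg-eq : ∀ a d → a * - d ≡ - a * d
  neg-neg-eq = solve-∀

  round-ℕ : ∀ k n .{{_ : ℕ.NonZero n}} → ∃[ a ] ∃[ r ] k ≡ a * + n + r × + 4 * (r * r) ≤ + n * + n
  round-ℕ k n with + 2 * + (k %ℕ n) ℤ.≤? + n
  ... | yes 2r≤n = k /ℕ n , + (k %ℕ n) ,
    trans (a≡a%ℕn+[a/ℕn]*n k n) (round-eq (k /ℕ n) (+ n) (+ (k %ℕ n))) ,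
    ≤-by _ (0≤* (ℤ.i≤j⇒0≤j-i 2r≤n) (0≤+ (+≤+ ℕ.z≤n) (0≤* {+ 2} {+ (k %ℕ n)} (+≤+ ℕ.z≤n) (+≤+ ℕ.z≤n))))
      (square-4-eq (+ n) (+ (k %ℕ n)))
  ... | no 2r≰n = k /ℕ n + 1ℤ , + (k %ℕ n) - + n ,
    trans (a≡a%ℕn+[a/ℕn]*n k n) (round-eq′ (k /ℕ n) (+ n) (+ (k %ℕ n))) ,
    ≤-by _ (0≤* (ℤ.i≤j⇒0≤j-i (ℤ.<⇒≤ (ℤ.≰⇒> 2r≰n)))
                (0≤+ (0≤* 0≤2 (ℤ.<⇒≤ (i<j⇒0<j-i (+<+ (n%ℕd<d k n))))) (+≤+ ℕ.z≤n)))
      (square-4-eq′ (+ n) (+ (k %ℕ n)))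

-- Nearest multiple of `d`. The bound on the remainder is squared, which makes it insensitive to the
-- signs of `r` and `d`.
round : ∀ k {d} → d ≢ 0ℤ → ∃[ a ] ∃[ r ] k ≡ a * d + r × + 4 * (r * r) ≤ d * d
round k {d} d≢0 with round-ℕ k ∣ d ∣ {{≢-nonZero d≢0}} | ℤ.+∣i∣≡i⊎+∣i∣≡-i d
... | a , r , eq , le | inj₁ eq′ = a , r , trans eq (cong (λ d → a * d + r) eq′) , subst (_ ≤_) (abs-square d) le
... | a , r , eq , le | inj₂ eq′ = - a , r ,
  trans eq (trans (cong (λ d → a * d + r) eq′) (cong (_+ r) (neg-neg-eq a d))) , subst (_ ≤_) (abs-square d) le

minimal-norms : ∀ {Λ x y} → Minimal Λ x → Minimal Λ y → ‖ x ‖² ≡ ‖ y ‖²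
minimal-norms (x∈Λ , x≢𝟎 , x-min) (y∈Λ , y≢𝟎 , y-min) = ℤ.≤-antisym (x-min _ y∈Λ y≢𝟎) (y-min _ x∈Λ x≢𝟎)

private
  residue-eq : ∀ D K L w a b r s x y → D * w ≡ K * x + L * y → K ≡ a * D + r → L ≡ b * D + s →
    D * (1ℤ * w + - 1ℤ * (a * x + b * y)) ≡ r * x + s * y
  residue-eq D K L w a b r s x y Dw≡ refl refl =
    trans (expand D w a b x y) (trans (cong (_- (a * D * x + b * D * y)) Dw≡) (collect D a b r s x y))
    where
    expand : ∀ D w a b x y → D * (1ℤ * w + - 1ℤ * (a * x + b * y)) ≡ D * w - (a * D * x + b * D * y)
    expand = solve-∀
    collect : ∀ D a b r s x y → (a * D + r) * x + (b * D + s) * y - (a * D * x + b * D * y) ≡ r * x + s * y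
    collect = solve-∀
  difference-eq : ∀ w c → 1ℤ * w + - 1ℤ * c ≡ w - c
  difference-eq = solve-∀
  -- Here `m` is the common norm of two minimal vectors, `I` their inner product and `N` the norm of
  -- the remainder. On the left, the first term will be zero, the second is nonnegative by
  -- minimality and the last two by rounding.
  parallelogram-eq : ∀ r s m I D N →
    + 2 * (r * r * m + s * s * m + + 2 * (r * s) * I - D * D * N) + + 2 * (D * D * (N - m)) +
      ((D * D - + 4 * (r * r)) * m + (D * D - + 4 * (s * s)) * m) ≡
    0ℤ - + 2 * (r * r * m + - s * - s * m + + 2 * (r * - s) * I)
  parallelogram-eq = solve-∀

  residue : ∀ {x y w} a b r s → w ∧ y ≡ a * (x ∧ y) + r → x ∧ w ≡ b * (x ∧ y) + s →
    (x ∧ y) • (1ℤ • w ⊕ - 1ℤ • (a • x ⊕ b • y)) ≡ r • x ⊕ s • y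
  residue {x@(x₁ , x₂)} {y@(y₁ , y₂)} {w@(w₁ , w₂)} a b r s eq₁ eq₂ = pair-ext
    (residue-eq (x ∧ y) (w ∧ y) (x ∧ w) w₁ a b r s x₁ y₁ (cong proj₁ (cramer x y w)) eq₁ eq₂)
    (residue-eq (x ∧ y) (w ∧ y) (x ∧ w) w₂ a b r s x₂ y₂ (cong proj₂ (cramer x y w)) eq₁ eq₂)

  difference≡𝟎 : ∀ w c → 1ℤ • w ⊕ - 1ℤ • c ≡ 𝟎 → w ≡ c
  difference≡𝟎 (w₁ , w₂) (c₁ , c₂) eq = pair-ext
    (ℤ.i-j≡0⇒i≡j w₁ c₁ (trans (sym (difference-eq w₁ c₁)) (cong proj₁ eq)))
    (ℤ.i-j≡0⇒i≡j w₂ c₂ (trans (sym (difference-eq w₂ c₂)) (cong proj₂ eq)))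

-- Round the coordinates of w with respect to x and y.  If the remainder w′ were
-- nonzero, minimality would leave no room in the parallelogram law: with
-- (x ∧ y) w′ = r x + s y and 2∣r∣, 2∣s∣ ≤ ∣x ∧ y∣ it forces ‖r x − s y‖² ≤ 0.
small-residue⇒≡ : ∀ Λ {x y} → Minimal Λ x → Minimal Λ y → LinearlyIndependent x y →
  ∀ {w} → w ∈ ⟦ Λ ⟧ → ∀ a b r s → w ∧ y ≡ a * (x ∧ y) + r → x ∧ w ≡ b * (x ∧ y) + s →
  + 4 * (r * r) ≤ (x ∧ y) * (x ∧ y) → + 4 * (s * s) ≤ (x ∧ y) * (x ∧ y) → w ≡ a • x ⊕ b • y
small-residue⇒≡ Λ {x} {y} x-min@(x∈Λ , x≢𝟎 , x-least) y-min ind {w} w∈Λ a b r s eq₁ eq₂ r-small s-small =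
  difference≡𝟎 w (a • x ⊕ b • y) w′≡𝟎
  where
  D = x ∧ y
  D≢0 = independent⇒wedge≢0 x y ind
  w′ = 1ℤ • w ⊕ - 1ℤ • (a • x ⊕ b • y)
  w′∈Λ : w′ ∈ ⟦ Λ ⟧
  w′∈Λ = ⟦⟧-lin Λ 1ℤ (- 1ℤ) w∈Λ (⟦⟧-lin Λ a b x∈Λ (proj₁ y-min))
  Dw′ : D • w′ ≡ r • x ⊕ s • y
  Dw′ = residue a b r s eq₁ eq₂
  m = ‖ x ‖²
  I = ⟨ x , y ⟩
  m≡ : ‖ y ‖² ≡ m
  m≡ = minimal-norms {Λ} {y} {x} y-min x-min
  norm₁ : r * r * m + s * s * m + + 2 * (r * s) * I - D * D * ‖ w′ ‖² ≡ 0ℤ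
  norm₁ = ℤ.i≡j⇒i-j≡0 (trans (cong (λ k → r * r * m + s * s * k + + 2 * (r * s) * I) (sym m≡))
    (trans (sym (norm-lin r s x y)) (trans (cong ‖_‖² (sym Dw′)) (norm-scale D w′))))
  norm₂ : ‖ r • x ⊕ - s • y ‖² ≡ r * r * m + - s * - s * m + + 2 * (r * - s) * I
  norm₂ = trans (norm-lin r (- s) x y) (cong (λ k → r * r * m + - s * - s * k + + 2 * (r * - s) * I) m≡)
  0≤m = 0≤norm x
  w′≡𝟎 : w′ ≡ 𝟎
  w′≡𝟎 with ≡𝟎? w′
  ... | yes eq = eq
  ... | no w′≢𝟎 = •≡𝟎 w′ D≢0 (trans Dw′ (trans (cong₂ (λ r s → r • x ⊕ s • y) r≡0 s≡0) refl))
    where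
    2N₂≤0 : + 2 * ‖ r • x ⊕ - s • y ‖² ≤ 0ℤ
    2N₂≤0 = ≤-by _
      (0≤+ (0≤+ {+ 2 * (r * r * m + s * s * m + + 2 * (r * s) * I - D * D * ‖ w′ ‖²)}
                (ℤ.≤-reflexive (cong (+ 2 *_) (sym norm₁)))
                (0≤* 0≤2 (0≤* (0≤i*i D) (ℤ.i≤j⇒0≤j-i (x-least w′ w′∈Λ w′≢𝟎)))))
           (0≤+ (0≤* (ℤ.i≤j⇒0≤j-i r-small) 0≤m) (0≤* (ℤ.i≤j⇒0≤j-i s-small) 0≤m)))
      (trans (parallelogram-eq r s m I D ‖ w′ ‖²) (cong (λ k → 0ℤ - + 2 * k) (sym norm₂)))
    rx-sy≡𝟎 : r • x ⊕ - s • y ≡ 𝟎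
    rx-sy≡𝟎 = norm≡0⇒≡𝟎 (r • x ⊕ - s • y) (ℤ.≤-antisym (ℤ.*-cancelˡ-≤-pos ‖ r • x ⊕ - s • y ‖² 0ℤ (+ 2) 2N₂≤0) (0≤norm (r • x ⊕ - s • y)))
    r≡0 : r ≡ 0ℤ
    r≡0 = proj₁ (ind r (- s) rx-sy≡𝟎)
    s≡0 : s ≡ 0ℤ
    s≡0 = ℤ.neg-injective {s} {0ℤ} (proj₂ (ind r (- s) rx-sy≡𝟎))

minimal-basis : ∀ Λ {x y} → Minimal Λ x → Minimal Λ y → LinearlyIndependent x y →
  ∀ w → w ∈ ⟦ Λ ⟧ → ∃[ m ] ∃[ n ] w ≡ m • x ⊕ n • y
minimal-basis Λ {x} {y} x-min y-min ind w w∈Λ =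
  let a , r , eq₁ , r-small = round (w ∧ y) (independent⇒wedge≢0 x y ind)
      b , s , eq₂ , s-small = round (x ∧ w) (independent⇒wedge≢0 x y ind)
  in a , b , small-residue⇒≡ Λ x-min y-min ind w∈Λ a b r s eq₁ eq₂ r-small s-small

Generated : (x y : ℤ²) → Pred ℤ² _
Generated x y w = ∃[ m ] ∃[ n ] w ≡ m • x ⊕ n • y

generated⇒∣ : ∀ {x y u v} → Generated x y u → Generated x y v → (x ∧ y) ∣ℤ (u ∧ v)
generated⇒∣ {x} {y} (a , b , refl) (c , d , refl) = divides (a * d - b * c) (wedge-lin a b c d x y)

-- Both pairs are bases, so each determinant divides the other.
wedge-invariant : ∀ Λ {x y u v} → Minimal Λ x → Minimal Λ y → LinearlyIndependent x y →
  Minimal Λ u → Minimal Λ v → LinearlyIndependent u v → ∣ x ∧ y ∣ ≡ ∣ u ∧ v ∣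
wedge-invariant Λ x y xy u v uv = ℕ.∣-antisym
  (∣⇒∣ᵤ (generated⇒∣ (minimal-basis Λ x y xy _ (proj₁ u)) (minimal-basis Λ x y xy _ (proj₁ v))))
  (∣⇒∣ᵤ (generated⇒∣ (minimal-basis Λ u v uv _ (proj₁ x)) (minimal-basis Λ u v uv _ (proj₁ y))))

private
  ratio-eq₁ : ∀ p q′ m → p * q′ * m ≡ q′ * (p * m)
  ratio-eq₁ = solve-∀
  ratio-eq₂ : ∀ q q′ d → q′ * (q * d) ≡ q * (q′ * d)
  ratio-eq₂ = solve-∀
  ratio-eq₃ : ∀ p′ q m → q * (p′ * m) ≡ p′ * q * m
  ratio-eq₃ = solve-∀

sinθ-unique : ∀ Λ {p q p′ q′} → (Sinθ≡ p / q) Λ → (Sinθ≡ p′ / q′) Λ → p ℕ.* q′ ≡ p′ ℕ.* q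
sinθ-unique Λ {p} {q} {p′} {q′} (x , y , x-min , y-min , xy , _ , eq) (u , v , u-min , v-min , uv , _ , eq′) =
  ℤ.+-injective (trans (ℤ.pos-* p q′) (trans
    (ℤ.*-cancelʳ-≡ (+ p * + q′) (+ p′ * + q) m {{≢-nonZero (ℤ.<⇒≢ (0<norm (proj₁ (proj₂ x-min))) ∘ sym)}}
      (trans (ratio-eq₁ (+ p) (+ q′) m)
      (trans (cong (+ q′ *_) (sym eq))
      (trans (ratio-eq₂ (+ q) (+ q′) (+ ∣ x ∧ y ∣))
      (trans (cong (+ q *_) eq″)
             (ratio-eq₃ (+ p′) (+ q) m))))))
    (sym (ℤ.pos-* p′ q))))
  where
  m = ‖ x ‖²
  eq″ : + q′ * + ∣ x ∧ y ∣ ≡ + p′ * m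
  eq″ = trans (cong (λ d → + q′ * + d) (wedge-invariant Λ x-min y-min xy u-min v-min uv))
    (trans eq′ (cong (+ p′ *_) (minimal-norms {Λ} {u} {x} u-min x-min)))

-- Reduced bases and well-rounded lattices

private
  -- The excess of the norm over `Q` is affine in `I`, hence a combination of its values at the ends
  -- of 0 ≤ 2 I ≤ Q: the square lattice at I = 0 and the hexagonal one at 2 I = Q.
  convex-eq : ∀ m n Q I → (Q - + 2 * I) * (m * m + n * n - 1ℤ) + I * (m * m + n * n + (m + n) * (m + n) - + 2) ≡
    m * m * Q + n * n * Q + + 2 * (m * n) * I - Q
  convex-eq = solve-∀

  0<i⇒1≤i : ∀ {i} → 0ℤ < i → 1ℤ ≤ i
  0<i⇒1≤i = ℤ.i<j⇒suc[i]≤j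

  0<m²+n² : ∀ m n → ¬ (m ≡ 0ℤ × n ≡ 0ℤ) → 0ℤ < m * m + n * n
  0<m²+n² m n ≢0 = 0<norm {m , n} λ { refl → ≢0 (refl , refl) }

  -- The sum of the three squares is 2 (m² + n² + m n), so being positive it is at least 2.
  even-positive : ∀ m n → 0ℤ < m * m + n * n → + 2 ≤ m * m + n * n + (m + n) * (m + n)
  even-positive m n 0<k = subst (+ 2 ≤_) (double-eq m n) (ℤ.*-monoˡ-≤-nonNeg (+ 2) {1ℤ} (0<i⇒1≤i 0<half))
    where
    double-eq : ∀ m n → + 2 * (m * m + n * n + m * n) ≡ m * m + n * n + (m + n) * (m + n)
    double-eq = solve-∀
    0<half : 0ℤ < m * m + n * n + m * n
    0<half = 0<*⇒0< 0<2 (subst (0ℤ <_) (sym (double-eq m n)) (0<+ 0<k (0≤i*i (m + n))))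

reduced-least : ∀ {x y} → ‖ x ‖² ≡ ‖ y ‖² → 0ℤ ≤ ⟨ x , y ⟩ → + 2 * ⟨ x , y ⟩ ≤ ‖ x ‖² →
  ∀ w → Generated x y w → w ≢ 𝟎 → ‖ x ‖² ≤ ‖ w ‖²
reduced-least {x} {y} eq 0≤I 2I≤Q w (m , n , refl) w≢𝟎 = ≤-by _
  (0≤+ (0≤* (ℤ.i≤j⇒0≤j-i 2I≤Q) (ℤ.i≤j⇒0≤j-i (0<i⇒1≤i 0<k)))
       (0≤* 0≤I (ℤ.i≤j⇒0≤j-i (even-positive m n 0<k))))
  (trans (convex-eq m n ‖ x ‖² ⟨ x , y ⟩) (cong (_- ‖ x ‖²)
    (trans (cong (λ Q → m * m * ‖ x ‖² + n * n * Q + + 2 * (m * n) * ⟨ x , y ⟩) eq) (sym (norm-lin m n x y)))))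
  where
  0<k = 0<m²+n² m n λ { (refl , refl) → w≢𝟎 refl }

minimal⇒WR : ∀ Λ {x y} → Minimal Λ x → Minimal Λ y → LinearlyIndependent x y → WR Λ
minimal⇒WR Λ {x} {y} x-min y-min ind w = x ∧ y , independent⇒wedge≢0 x y ind ,
  subst (Spanℤ (Minimal Λ)) (trans (cong ((w ∧ y) • x ⊕_) (⊕-identityʳ _)) (sym (cramer x y w)))
    (add (w ∧ y) x-min (add (x ∧ w) y-min empty))
  where
  ⊕-identityʳ : ∀ v → v ⊕ 𝟎 ≡ v
  ⊕-identityʳ (v₁ , v₂) = pair-ext (ℤ.+-identityʳ v₁) (ℤ.+-identityʳ v₂)

independent⇒≢𝟎 : ∀ {x y} → LinearlyIndependent x y → x ≢ 𝟎
independent⇒≢𝟎 {x} {y₁ , y₂} ind refl with proj₁ (ind 1ℤ 0ℤ refl)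
... | ()

∈-left : ∀ Λ → b₁ Λ ∈ ⟦ Λ ⟧
∈-left Λ = 1ℤ , 0ℤ , sym (eq (b₁ Λ) (b₂ Λ))
  where
  eq₁ : ∀ x y → 1ℤ * x + 0ℤ * y ≡ x
  eq₁ = solve-∀
  eq : ∀ x y → 1ℤ • x ⊕ 0ℤ • y ≡ x
  eq (x₁ , x₂) (y₁ , y₂) = pair-ext (eq₁ x₁ y₁) (eq₁ x₂ y₂)

∈-right : ∀ Λ → b₂ Λ ∈ ⟦ Λ ⟧
∈-right Λ = 0ℤ , 1ℤ , sym (eq (b₁ Λ) (b₂ Λ))
  where
  eq₁ : ∀ x y → 0ℤ * x + 1ℤ * y ≡ y
  eq₁ = solve-∀
  eq : ∀ x y → 0ℤ • x ⊕ 1ℤ • y ≡ y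
  eq (x₁ , x₂) (y₁ , y₂) = pair-ext (eq₁ x₁ y₁) (eq₁ x₂ y₂)

-- Orthogonal lattices and the class C(1 , 1)

private
  orthogonal-norm-eq : ∀ m n U V → m * m * U + n * n * V + + 2 * (m * n) * 0ℤ ≡ m * m * U + n * n * V
  orthogonal-norm-eq = solve-∀
  orthogonal-bound-eq : ∀ m n U V → m * m * U + ((n * n - 1ℤ) * V + (V - U)) ≡ m * m * U + n * n * V - U
  orthogonal-bound-eq = solve-∀
  wedge-self-eq : ∀ m u₁ u₂ v₁ v₂ → (m * u₁ + 0ℤ * v₁) * u₂ - (m * u₂ + 0ℤ * v₂) * u₁ ≡ 0ℤ
  wedge-self-eq = solve-∀
  wedge-swap-eq : ∀ u₁ u₂ v₁ v₂ → v₁ * u₂ - v₂ * u₁ ≡ - (u₁ * v₂ - u₂ * v₁)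
  wedge-swap-eq = solve-∀

  wedge-self : ∀ m u v → (m • u ⊕ 0ℤ • v) ∧ u ≡ 0ℤ
  wedge-self m (u₁ , u₂) (v₁ , v₂) = wedge-self-eq m u₁ u₂ v₁ v₂

  wedge-swap : ∀ u v → v ∧ u ≡ - (u ∧ v)
  wedge-swap (u₁ , u₂) (v₁ , v₂) = wedge-swap-eq u₁ u₂ v₁ v₂

  wedge-𝟎 : ∀ u → 𝟎 ∧ u ≡ 0ℤ
  wedge-𝟎 (u₁ , u₂) = eq u₂ u₁
    where
    eq : ∀ x y → 0ℤ * x - 0ℤ * y ≡ 0ℤ
    eq = solve-∀

module _ (Λ : Sublattice) {u v : ℤ²} (u∈Λ : u ∈ ⟦ Λ ⟧) (u≢𝟎 : u ≢ 𝟎)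
  (generate : ∀ w → w ∈ ⟦ Λ ⟧ → Generated u v w) (u⊥v : ⟨ u , v ⟩ ≡ 0ℤ) where

  orthogonal-short⇒minimal-parallel : ‖ u ‖² < ‖ v ‖² → ∀ {w} → Minimal Λ w → w ∧ u ≡ 0ℤ
  orthogonal-short⇒minimal-parallel u<v {w} (w∈Λ , w≢𝟎 , least) with generate w w∈Λ
  ... | m , n , refl with n ℤ.≟ 0ℤ
  ...   | yes refl = wedge-self m u v
  ...   | no n≢0 = ⊥-elim (ℤ.<⇒≱ u<w (least u u∈Λ u≢𝟎))
    where
    u<w : ‖ u ‖² < ‖ m • u ⊕ n • v ‖²
    u<w = <-by (m * m * ‖ u ‖² + ((n * n - 1ℤ) * ‖ v ‖² + (‖ v ‖² - ‖ u ‖²)))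
      (ℤ.+-mono-≤-< (0≤* (0≤i*i m) (0≤norm u)) (ℤ.+-mono-≤-<
        (0≤* (ℤ.i≤j⇒0≤j-i (ℤ.i<j⇒suc[i]≤j (i≢0⇒0<i*i n≢0))) (0≤norm v)) (i<j⇒0<j-i u<v)))
      (trans (orthogonal-bound-eq m n ‖ u ‖² ‖ v ‖²) (cong (_- ‖ u ‖²)
        (trans (sym (orthogonal-norm-eq m n ‖ u ‖² ‖ v ‖²))
        (trans (cong (λ I → m * m * ‖ u ‖² + n * n * ‖ v ‖² + + 2 * (m * n) * I) (sym u⊥v))
               (sym (norm-lin m n u v))))))

  -- The determinant against `u` is linear and vanishes on minimal vectors, so it vanishes on their
  -- span, which contains no nonzero multiple of `v`.
  orthogonal-short⇒¬WR : u ∧ v ≢ 0ℤ → ‖ u ‖² < ‖ v ‖² → ¬ WR Λ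
  orthogonal-short⇒¬WR u∧v≢0 u<v wr with wr v
  ... | n , n≢0 , span = u∧v≢0 (ℤ.neg-injective {u ∧ v} {0ℤ} (trans (sym (wedge-swap u v))
      (*≡0 n≢0 (trans (sym (wedge-scale n v u)) (parallel span)))))
    where
    parallel : ∀ {w} → Spanℤ (Minimal Λ) w → w ∧ u ≡ 0ℤ
    parallel empty = wedge-𝟎 u
    parallel (add m {x} {y} x-min s) = trans (wedge-add m x y u)
      (trans (cong₂ (λ i j → m * i + j) (orthogonal-short⇒minimal-parallel u<v x-min) (parallel s))
             (trans (ℤ.+-identityʳ (m * 0ℤ)) (ℤ.*-zeroʳ m)))

Generated-swap : ∀ {x y w} → Generated x y w → Generated y x w
Generated-swap {x₁ , x₂} {y₁ , y₂} (m , n , refl) = n , m , pair-ext (ℤ.+-comm (m * x₁) _) (ℤ.+-comm (m * x₂) _)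

⟨⟩-comm : ∀ x y → ⟨ x , y ⟩ ≡ ⟨ y , x ⟩
⟨⟩-comm (x₁ , x₂) (y₁ , y₂) = cong₂ _+_ (ℤ.*-comm x₁ y₁) (ℤ.*-comm x₂ y₂)

private
  i+j≡j⇒i≡0 : ∀ i j → i + j ≡ j → i ≡ 0ℤ
  i+j≡j⇒i≡0 i j eq = trans (cancel i j) (trans (cong (_- j) eq) (ℤ.+-inverseʳ j))
    where
    cancel : ∀ i j → i ≡ i + j - j
    cancel = solve-∀

-- With sine 1 the squared determinant already equals the product of the norms, and Lagrange's
-- identity leaves nothing for the inner product.
C₁₁⇒orthogonal : ∀ Λ → (Sinθ≡ 1 / 1) Λ → Orthogonal Λ
C₁₁⇒orthogonal Λ (x , y , x-min , y-min , ind , _ , eq) =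
  x , y , proj₁ x-min , proj₁ y-min , minimal-basis Λ x-min y-min ind ,
  i*i≡0⇒i≡0 I (i+j≡j⇒i≡0 (I * I) (D * D)
    (trans (lagrange x y) (trans (cong (‖ x ‖² *_) (minimal-norms {Λ} {y} {x} y-min x-min))
    (trans (sym (cong (λ d → d * d) D≡)) (abs-square D)))))
  where
  I = ⟨ x , y ⟩
  D = x ∧ y
  D≡ : + ∣ D ∣ ≡ ‖ x ‖²
  D≡ = trans (sym (ℤ.*-identityˡ (+ ∣ D ∣))) (trans eq (ℤ.*-identityˡ ‖ x ‖²))

-- An orthogonal basis may have two different lengths. Well-roundedness excludes this, as all
-- minimal vectors would be parallel to the shorter one; with equal lengths both basis vectors are
-- minimal.
orthogonal⇒C₁₁ : ∀ Λ → WR Λ → Orthogonal Λ → (Sinθ≡ 1 / 1) Λ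
orthogonal⇒C₁₁ Λ wr (x , y , x∈Λ , y∈Λ , generate , x⊥y) =
  x , y , x-min , y-min , ind , ℤ.≤-reflexive (sym x⊥y) ,
  cong (1ℤ *_) (square-injective (+≤+ ℕ.z≤n) (0≤norm x)
    (trans (abs-square (x ∧ y)) (trans (sym (ℤ.+-identityˡ _))
    (trans (cong (λ I → I * I + (x ∧ y) * (x ∧ y)) (sym x⊥y))
    (trans (lagrange x y) (cong (‖ x ‖² *_) (sym norms)))))))
  where
  x∧y≢0 : x ∧ y ≢ 0ℤ
  -- `x` and `y` generate `b₁` and `b₂`, so their determinant divides a nonzero one.
  x∧y≢0 x∧y≡0 = independent⇒wedge≢0 (b₁ Λ) (b₂ Λ) (independent Λ)
    (ℤ∣.0∣⇒≡0 (subst (_∣ℤ (b₁ Λ ∧ b₂ Λ)) x∧y≡0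
      (generated⇒∣ (generate _ (∈-left Λ)) (generate _ (∈-right Λ)))))
  y∧x≢0 : y ∧ x ≢ 0ℤ
  y∧x≢0 eq = x∧y≢0 (ℤ.neg-injective {x ∧ y} {0ℤ} (trans (sym (wedge-swap x y)) eq))
  ind : LinearlyIndependent x y
  ind = wedge≢0⇒independent x y x∧y≢0
  x≢𝟎 : x ≢ 𝟎
  x≢𝟎 = independent⇒≢𝟎 ind
  y≢𝟎 : y ≢ 𝟎
  y≢𝟎 = independent⇒≢𝟎 (wedge≢0⇒independent y x y∧x≢0)
  norms : ‖ x ‖² ≡ ‖ y ‖²
  norms with ℤ.<-cmp ‖ x ‖² ‖ y ‖²
  ... | tri< x<y _ _ = ⊥-elim (orthogonal-short⇒¬WR Λ x∈Λ x≢𝟎 generate x⊥y x∧y≢0 x<y wr)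
  ... | tri≈ _ eq _ = eq
  ... | tri> _ _ y<x = ⊥-elim (orthogonal-short⇒¬WR Λ y∈Λ y≢𝟎 (λ w w∈Λ → Generated-swap (generate w w∈Λ))
                         (trans (⟨⟩-comm y x) x⊥y) y∧x≢0 y<x wr)
  least : ∀ w → w ∈ ⟦ Λ ⟧ → w ≢ 𝟎 → ‖ x ‖² ≤ ‖ w ‖²
  least w w∈Λ = reduced-least norms (ℤ.≤-reflexive (sym x⊥y))
    (subst (λ I → + 2 * I ≤ ‖ x ‖²) (sym x⊥y) (0≤norm x)) w (generate w w∈Λ)
  x-min : Minimal Λ x
  x-min = x∈Λ , x≢𝟎 , least
  y-min : Minimal Λ y
  y-min = y∈Λ , y≢𝟎 , λ w w∈Λ w≢𝟎 → subst (_≤ ‖ w ‖²) norms (least w w∈Λ w≢𝟎)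

C₁₁⇔orthogonal : ∀ Λ → Λ ∈ C⟨ 1 , 1 ⟩ ⇔ (Λ ∈ WR × Λ ∈ Orthogonal)
C₁₁⇔orthogonal Λ = mk⇔ (λ (wr , s) → wr , C₁₁⇒orthogonal Λ s) (λ (wr , o) → wr , orthogonal⇒C₁₁ Λ wr o)

-- Both vectors have length `q`, at an angle with cosine r / q and sine p / q. That `2 ℕ.* r ℕ.≤ q`
-- keeps the angle at least π/3, which makes both of them minimal.
C-inhabited : ∀ p q r → 0 ℕ.< p → 0 ℕ.< q → Leg p q r → 2 ℕ.* r ℕ.≤ q → ∃ C⟨ p , q ⟩
C-inhabited p q r 0<p 0<q leg 2r≤q = Λ , minimal⇒WR Λ x-min y-min ind ,
  x , y , x-min , y-min , ind , 0≤I , trans (cong (+ q *_) ∣x∧y∣≡) (ratio-eq (+ q) (+ p))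
  where
  x y : ℤ²
  x = + q , 0ℤ
  y = + r , + p
  wedge-eq : ∀ q p r → q * p - 0ℤ * r ≡ q * p
  wedge-eq = solve-∀
  norm-eq : ∀ q → q * q ≡ q * q + 0ℤ * 0ℤ
  norm-eq = solve-∀
  ratio-eq : ∀ q p → q * (q * p) ≡ p * (q * q + 0ℤ * 0ℤ)
  ratio-eq = solve-∀
  inner-eq : ∀ q r p → q * (+ 2 * r) ≡ + 2 * (q * r + 0ℤ * p)
  inner-eq = solve-∀
  x∧y≡ : x ∧ y ≡ + q * + p
  x∧y≡ = wedge-eq (+ q) (+ p) (+ r)
  ∣x∧y∣≡ : + ∣ x ∧ y ∣ ≡ + q * + p
  ∣x∧y∣≡ = trans (cong (+_ ∘ ∣_∣) x∧y≡) (ℤ.0≤i⇒+∣i∣≡i (0≤* {+ q} {+ p} (+≤+ ℕ.z≤n) (+≤+ ℕ.z≤n)))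
  ind : LinearlyIndependent x y
  ind = wedge≢0⇒independent x y λ eq → ℤ.<⇒≢ (0<* (+<+ 0<q) (+<+ 0<p)) (trans (sym eq) x∧y≡)
  Λ : Sublattice
  Λ = record { b₁ = x ; b₂ = y ; independent = ind }
  norms : ‖ x ‖² ≡ ‖ y ‖²
  norms = trans (sym (norm-eq (+ q))) (trans (sym (ℤ.pos-* q q)) (trans (cong +_ (sym leg))
    (cong₂ _+_ (ℤ.pos-* r r) (ℤ.pos-* p p))))
  0≤I : 0ℤ ≤ ⟨ x , y ⟩
  0≤I = 0≤+ {+ q * + r} {0ℤ * + p} (0≤* {+ q} {+ r} (+≤+ ℕ.z≤n) (+≤+ ℕ.z≤n)) (+≤+ ℕ.z≤n)
  2I≤Q : + 2 * ⟨ x , y ⟩ ≤ ‖ x ‖²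
  2I≤Q = subst₂ _≤_ (inner-eq (+ q) (+ r) (+ p)) (norm-eq (+ q))
    (ℤ.*-monoˡ-≤-nonNeg (+ q) (subst (_≤ + q) (ℤ.pos-* 2 r) (+≤+ 2r≤q)))
  x≢𝟎 : x ≢ 𝟎
  x≢𝟎 = independent⇒≢𝟎 ind
  y≢𝟎 : y ≢ 𝟎
  y≢𝟎 eq = ℤ.<⇒≢ (+<+ 0<p) (sym (cong proj₂ eq))
  x-min : Minimal Λ x
  x-min = ∈-left Λ , x≢𝟎 , reduced-least norms 0≤I 2I≤Q
  y-min : Minimal Λ y
  y-min = ∈-right Λ , y≢𝟎 , λ w w∈Λ w≢𝟎 → subst (_≤ ‖ w ‖²) norms (reduced-least norms 0≤I 2I≤Q w w∈Λ w≢𝟎)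

-- The classes C(p , q)

ℕ-square-cancel-< : ∀ {m n} → m ℕ.* m ℕ.< n ℕ.* n → m ℕ.< n
ℕ-square-cancel-< {m} {n} mm<nn with m ℕ.<? n
... | yes m<n = m<n
... | no m≮n = ⊥-elim (ℕ.<⇒≱ mm<nn (ℕ.*-mono-≤ (ℕ.≮⇒≥ m≮n) (ℕ.≮⇒≥ m≮n)))

ℕ-square-injective : ∀ {m n} → m ℕ.* m ≡ n ℕ.* n → m ≡ n
ℕ-square-injective {m} {n} eq with ℕ.<-cmp m n
... | tri< m<n _ _ = ⊥-elim (ℕ.<⇒≢ (ℕ.*-mono-< m<n m<n) eq)
... | tri≈ _ m≡n _ = m≡n
... | tri> _ _ n<m = ⊥-elim (ℕ.<⇒≢ (ℕ.*-mono-< n<m n<m) (sym eq))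

leg-unique : ∀ {p q r r′} → Leg p q r → Leg p q r′ → r ≡ r′
leg-unique {p} l l′ = ℕ-square-injective (ℕ.+-cancelʳ-≡ (p ℕ.* p) _ _ (trans l (sym l′)))

𝒮-leg : ∀ {p q} → 𝒮 p q → ∃ (Leg p q)
𝒮-leg (inj₁ (_ , _ , _ , l)) = l
𝒮-leg (inj₂ (refl , refl)) = 0 , refl

𝒮-gcd : ∀ {p q} → 𝒮 p q → ℕ.gcd p q ≡ 1
𝒮-gcd (inj₁ (_ , _ , g , _)) = g
𝒮-gcd (inj₂ (refl , refl)) = refl

private
  2m-square : ∀ m → 2 ℕ.* m ℕ.* (2 ℕ.* m) ≡ 4 ℕ.* (m ℕ.* m)
  2m-square = ℕ-Ring.solve-∀
  4-legs : ∀ r p → 4 ℕ.* (r ℕ.* r) ℕ.+ 4 ℕ.* (p ℕ.* p) ≡ 4 ℕ.* (r ℕ.* r ℕ.+ p ℕ.* p)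
  4-legs = ℕ-Ring.solve-∀
  4≡1+3 : ∀ m → 4 ℕ.* m ≡ m ℕ.+ 3 ℕ.* m
  4≡1+3 = ℕ-Ring.solve-∀

-- Compare 4 r² + 4 p² with q² + 3 q²: the two are equal. This turns the bound on the sine into the
-- condition that defines 𝒫.
cos<½⇔√3/2<sin : ∀ {p q r} → Leg p q r →
  (3 ℕ.* (q ℕ.* q) ℕ.< 4 ℕ.* (p ℕ.* p) → 2 ℕ.* r ℕ.< q) × (2 ℕ.* r ℕ.< q → 3 ℕ.* (q ℕ.* q) ℕ.< 4 ℕ.* (p ℕ.* p))
cos<½⇔√3/2<sin {p} {q} {r} leg =
  (λ lt → ℕ-square-cancel-< (subst (ℕ._< q ℕ.* q) (sym (2m-square r))
    (ℕ.+-cancelʳ-< (3 ℕ.* (q ℕ.* q)) (4 ℕ.* (r ℕ.* r)) (q ℕ.* q) (subst (4 ℕ.* (r ℕ.* r) ℕ.+ 3 ℕ.* (q ℕ.* q) ℕ.<_) sum (ℕ.+-monoʳ-< (4 ℕ.* (r ℕ.* r)) lt))))) ,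
  (λ lt → ℕ.+-cancelˡ-< (4 ℕ.* (r ℕ.* r)) (3 ℕ.* (q ℕ.* q)) (4 ℕ.* (p ℕ.* p)) (subst (4 ℕ.* (r ℕ.* r) ℕ.+ 3 ℕ.* (q ℕ.* q) ℕ.<_) (sym sum)
    (ℕ.+-monoˡ-< (3 ℕ.* (q ℕ.* q)) (subst (ℕ._< q ℕ.* q) (2m-square r) (ℕ.*-mono-< lt lt)))))
  where
  sum : 4 ℕ.* (r ℕ.* r) ℕ.+ 4 ℕ.* (p ℕ.* p) ≡ q ℕ.* q ℕ.+ 3 ℕ.* (q ℕ.* q)
  sum = trans (4-legs r p) (trans (cong (4 ℕ.*_) leg) (4≡1+3 (q ℕ.* q)))

leg-of-1/1 : ∀ {r} → Leg 1 1 r → r ≡ 0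
leg-of-1/1 {r} l = leg-unique {1} {1} {r} {0} l refl

𝒮-leg-short : ∀ {p q r} → 𝒮 p q → Leg p q r → 2 ℕ.* r ℕ.< q
𝒮-leg-short {p} {q} {r} (inj₁ (√3/2<p/q , _)) leg = proj₁ (cos<½⇔√3/2<sin {p} {q} {r} leg) √3/2<p/q
𝒮-leg-short {r = r} (inj₂ (refl , refl)) leg = subst (λ r → 2 ℕ.* r ℕ.< 1) (sym (leg-of-1/1 {r} leg)) ℕ.z<s

-- Together with `𝒮-leg-short` this tells `p` from the other leg, which a triple does not record.
𝒮-long : ∀ {p q} → 𝒮 p q → q ℕ.< 2 ℕ.* p
𝒮-long {p} {q} (inj₁ (√3/2<p/q , _)) = ℕ-square-cancel-< (subst (q ℕ.* q ℕ.<_) (sym (2m-square p))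
  (ℕ.≤-<-trans (ℕ.m≤n*m (q ℕ.* q) 3) √3/2<p/q))
𝒮-long (inj₂ (refl , refl)) = ℕ.s<s ℕ.z<s

𝒮-0<q : ∀ {p q} → 𝒮 p q → 0 ℕ.< q
𝒮-0<q s = ℕ.≤-<-trans ℕ.z≤n (𝒮-leg-short {r = proj₁ (𝒮-leg s)} s (proj₂ (𝒮-leg s)))

𝒮-0<p : ∀ {p q} → 𝒮 p q → 0 ℕ.< p
𝒮-0<p {zero} s = ⊥-elim (ℕ.<⇒≱ (𝒮-long s) ℕ.z≤n)
𝒮-0<p {suc p} s = ℕ.z<s

lowest-terms-unique : ∀ {p q p′ q′} → 0 ℕ.< p → ℕ.gcd p q ≡ 1 → ℕ.gcd p′ q′ ≡ 1 →
  p ℕ.* q′ ≡ p′ ℕ.* q → p ≡ p′ × q ≡ q′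
lowest-terms-unique {p} {q} {p′} {q′} 0<p g g′ eq = p≡p′ ,
  ℕ.*-cancelˡ-≡ q q′ p {{ℕ.>-nonZero 0<p}} (trans (cong (ℕ._* q) p≡p′) (sym eq))
  where
  p≡p′ : p ≡ p′
  p≡p′ = ℕ.∣-antisym
    (ℕ.coprime-divisor (ℕ.gcd≡1⇒coprime g) (subst (p ℕ.∣_) (trans eq (ℕ.*-comm p′ q)) (ℕ.m∣m*n q′)))
    (ℕ.coprime-divisor (ℕ.gcd≡1⇒coprime g′) (subst (p′ ℕ.∣_) (trans (sym eq) (ℕ.*-comm p q′)) (ℕ.m∣m*n q)))

C-nonempty : ∀ {p q} → 𝒮 p q → ∃ C⟨ p , q ⟩
C-nonempty {p} {q} s = C-inhabited p q r (𝒮-0<p s) (𝒮-0<q s) leg (ℕ.<⇒≤ (𝒮-leg-short {r = r} s leg))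
  where
  r = proj₁ (𝒮-leg s)
  leg = proj₂ (𝒮-leg s)

-- A single common member suffices, since its sine has only one expression in lowest terms.
C-injective : ∀ {p q p′ q′} → 𝒮 p q → 𝒮 p′ q′ → (∀ {Λ} → C⟨ p , q ⟩ Λ → C⟨ p′ , q′ ⟩ Λ) → p ≡ p′ × q ≡ q′
C-injective {p} {q} {p′} {q′} s s′ ⊆ = unique (C-nonempty s)
  where
  unique : ∃ C⟨ p , q ⟩ → p ≡ p′ × q ≡ q′
  unique (Λ , Λ∈C) =
    lowest-terms-unique (𝒮-0<p s) (𝒮-gcd s) (𝒮-gcd s′) (sinθ-unique Λ {p} {q} {p′} {q′} (proj₂ Λ∈C) (proj₂ (⊆ {Λ} Λ∈C)))

-- The bijection between classes and triples

even⊎odd : ∀ n → (∃[ k ] n ≡ 2 ℕ.* k) ⊎ (∃[ k ] n ≡ 1 ℕ.+ 2 ℕ.* k)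
even⊎odd zero = inj₁ (0 , refl)
even⊎odd (suc n) with even⊎odd n
... | inj₁ (k , refl) = inj₂ (k , refl)
... | inj₂ (k , refl) = inj₁ (suc k , cong suc (sym (ℕ.+-suc k (k ℕ.+ 0))))

private
  odd-legs : ∀ a b → (1 ℕ.+ 2 ℕ.* a) ℕ.* (1 ℕ.+ 2 ℕ.* a) ℕ.+ (1 ℕ.+ 2 ℕ.* b) ℕ.* (1 ℕ.+ 2 ℕ.* b) ≡
    2 ℕ.* (2 ℕ.* (a ℕ.* a ℕ.+ a ℕ.+ b ℕ.* b ℕ.+ b) ℕ.+ 1)
  odd-legs = ℕ-Ring.solve-∀
  even-square : ∀ c → 2 ℕ.* c ℕ.* (2 ℕ.* c) ≡ 2 ℕ.* (2 ℕ.* (c ℕ.* c))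
  even-square = ℕ-Ring.solve-∀
  odd-square : ∀ c → (1 ℕ.+ 2 ℕ.* c) ℕ.* (1 ℕ.+ 2 ℕ.* c) ≡ 2 ℕ.* (2 ℕ.* (c ℕ.* c ℕ.+ c)) ℕ.+ 1
  odd-square = ℕ-Ring.solve-∀

  even≢odd : ∀ m n → 2 ℕ.* m ≢ 2 ℕ.* n ℕ.+ 1
  even≢odd m n eq with ℕ.∣1⇒≡1 (ℕ.∣m+n∣m⇒∣n {2} {2 ℕ.* n} {1} (subst (2 ℕ.∣_) eq (ℕ.m∣m*n m)) (ℕ.m∣m*n n))
  ... | ()

-- Two odd legs would make q² congruent to 2 modulo 4.
leg-even : ∀ {p q r} → Leg p q r → ¬ (2 ℕ.∣ p) → 2 ℕ.∣ r
leg-even {p} {q} {r} leg 2∤p with even⊎odd p | even⊎odd r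
... | inj₁ (k , refl) | _ = ⊥-elim (2∤p (ℕ.m∣m*n k))
... | inj₂ _ | inj₁ (k , refl) = ℕ.m∣m*n k
... | inj₂ (b , refl) | inj₂ (a , refl) with even⊎odd q
...   | inj₁ (c , refl) = ⊥-elim (even≢odd (c ℕ.* c) (a ℕ.* a ℕ.+ a ℕ.+ b ℕ.* b ℕ.+ b)
        (ℕ.*-cancelˡ-≡ _ _ 2 (trans (sym (even-square c)) (trans (sym leg) (odd-legs a b)))))
...   | inj₂ (c , refl) = ⊥-elim (even≢odd (2 ℕ.* (a ℕ.* a ℕ.+ a ℕ.+ b ℕ.* b ℕ.+ b) ℕ.+ 1) (2 ℕ.* (c ℕ.* c ℕ.+ c))
        (trans (sym (odd-legs a b)) (trans leg (odd-square c))))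

arrange : (p q r : ℕ) → Dec (2 ℕ.∣ p) → Triple
arrange p q r (yes _) = + r ∷ + p ∷ + q ∷ []
arrange p q r (no _)  = + p ∷ + r ∷ + q ∷ []

private
  ℤ-leg : ∀ {p q r} → Leg p q r → + r * + r + + p * + p ≡ + q * + q
  ℤ-leg {p} {q} {r} leg =
    trans (cong₂ _+_ (sym (ℤ.pos-* r r)) (sym (ℤ.pos-* p p))) (trans (cong +_ leg) (ℤ.pos-* q q))

  gcd₃ : ∀ {p q} g → ℕ.gcd p q ≡ 1 → g ℕ.∣ p → ℕ.gcd g q ≡ 1
  gcd₃ {p} {q} g coprime g∣p = ℕ.∣1⇒≡1 (subst (ℕ.gcd g q ℕ.∣_) coprime
    (ℕ.gcd-greatest (ℕ.∣-trans (ℕ.gcd[m,n]∣m g q) g∣p) (ℕ.gcd[m,n]∣n g q)))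

  ℤ-short : ∀ {i r q} → i ≤ + r → 2 ℕ.* r ℕ.< q → + 2 * i < + q
  ℤ-short {i} {r} {q} i≤r 2r<q = ℤ.≤-<-trans (ℤ.*-monoˡ-≤-nonNeg (+ 2) i≤r)
    (subst (_< + q) (ℤ.pos-* 2 r) (+<+ 2r<q))

  0<leg : ∀ {p q r} → p ℕ.< q → Leg p q r → 0 ℕ.< r
  0<leg {p} {q} {zero} p<q leg = ⊥-elim (ℕ.<⇒≢ (ℕ.*-mono-< p<q p<q) leg)
  0<leg {r = suc r} p<q leg = ℕ.z<s

arrange∈𝒫 : ∀ {p q r} → 𝒮 p q → Leg p q r → ∀ d → 𝒫 (arrange p q r d)
arrange∈𝒫 (inj₂ (refl , refl)) leg (yes 2∣1) with ℕ.∣1⇒≡1 2∣1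
... | ()
arrange∈𝒫 {r = r} (inj₂ (refl , refl)) leg (no _) = inj₂ (cong (λ r → + 1 ∷ + r ∷ + 1 ∷ []) (leg-of-1/1 {r} leg))
arrange∈𝒫 {p} {q} {r} s@(inj₁ (_ , p<q , coprime , _)) leg (yes 2∣p) = inj₁
  ( (+<+ (0<leg {p} {q} {r} p<q leg) , +<+ (𝒮-0<p s) , +<+ (𝒮-0<q s) , 2∣p
    , cong +_ (gcd₃ (ℕ.gcd r p) coprime (ℕ.gcd[m,n]∣n r p)) , ℤ-leg {p} {q} {r} leg)
  , ℤ-short (ℤ.i⊓j≤i (+ r) (+ p)) (𝒮-leg-short {r = r} s leg))
arrange∈𝒫 {p} {q} {r} s@(inj₁ (_ , p<q , coprime , _)) leg (no 2∤p) = inj₁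
  ( (+<+ (𝒮-0<p s) , +<+ (0<leg {p} {q} {r} p<q leg) , +<+ (𝒮-0<q s) , leg-even {p} {q} {r} leg 2∤p
    , cong +_ (gcd₃ (ℕ.gcd p r) coprime (ℕ.gcd[m,n]∣m p r)) , trans (ℤ.+-comm (+ p * + p) (+ r * + r)) (ℤ-leg {p} {q} {r} leg))
  , ℤ-short (ℤ.i⊓j≤j (+ p) (+ r)) (𝒮-leg-short {r = r} s leg))

-- In the mixed cases the long leg of one class would be the short leg of the other, with the same
-- hypotenuse.
arrange-unique : ∀ {p q r} → 𝒮 p q → Leg p q r → ∀ {p′ q′ r′} → 𝒮 p′ q′ → Leg p′ q′ r′ → ∀ d d′ →
  arrange p q r d ≡ arrange p′ q′ r′ d′ → p ≡ p′ × q ≡ q′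
arrange-unique s l s′ l′ (yes _) (yes _) refl = refl , refl
arrange-unique s l s′ l′ (no _) (no _) refl = refl , refl
arrange-unique {r = r} s l s′ l′ (yes _) (no _) refl = ⊥-elim (ℕ.<-asym (𝒮-leg-short {r = r} s l) (𝒮-long s′))
arrange-unique s l {r′ = r′} s′ l′ (no _) (yes _) refl = ⊥-elim (ℕ.<-asym (𝒮-leg-short {r = r′} s′ l′) (𝒮-long s))

ψ-triple : 𝒞₂ → Triple
ψ-triple c = arrange p q (proj₁ (𝒮-leg p/q∈𝒮)) (2 ℕ.∣? p)
  where open 𝒞₂ c

ψ-triple-cong : ∀ c d → 𝒞₂.p c ≡ 𝒞₂.p d → 𝒞₂.q c ≡ 𝒞₂.q d → ψ-triple c ≡ ψ-triple d
ψ-triple-cong c@record { p/q∈𝒮 = s } d@record { p/q∈𝒮 = s′ } refl refl =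
  cong (λ r → arrange (𝒞₂.p c) (𝒞₂.q c) r (2 ℕ.∣? 𝒞₂.p c))
    (leg-unique {𝒞₂.p c} {𝒞₂.q c} (proj₂ (𝒮-leg s)) (proj₂ (𝒮-leg s′)))

module _ (c d : 𝒞₂) where
  private
    module c = 𝒞₂ c
    module d = 𝒞₂ d

  -- ψ is read off from the stored `p` and `q`; this is what makes it respect extensional equality.
  members-≐⇒ : c.members ≐ d.members → c.p ≡ d.p × c.q ≡ d.q
  members-≐⇒ (c⊆d , _) = C-injective c.p/q∈𝒮 d.p/q∈𝒮 (λ {Λ} → proj₁ d.isC {Λ} ∘ c⊆d {Λ} ∘ proj₂ c.isC {Λ})

  members-≐⇐ : c.p ≡ d.p → c.q ≡ d.q → c.members ≐ d.members
  members-≐⇐ p≡ q≡ =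
    (λ {Λ} → proj₂ d.isC ∘ subst₂ (λ p q → C⟨ p , q ⟩ Λ) p≡ q≡ ∘ proj₁ c.isC) ,
    (λ {Λ} → proj₂ c.isC ∘ subst₂ (λ p q → C⟨ p , q ⟩ Λ) (sym p≡) (sym q≡) ∘ proj₁ d.isC)

private
  -- The gcd of `p` and `q` divides r², and coprimality of the triple makes it prime to `r`; so it
  -- divides `r`, and then all three numbers.
  coprime-hypotenuse : ∀ {p q r} → Leg p q r → ℕ.gcd (ℕ.gcd r p) q ≡ 1 → ℕ.gcd p q ≡ 1
  coprime-hypotenuse {p} {q} {r} leg coprime = ℕ.∣1⇒≡1 (subst (g ℕ.∣_) coprime
      (ℕ.gcd-greatest (ℕ.gcd-greatest g∣r (ℕ.gcd[m,n]∣m p q)) (ℕ.gcd[m,n]∣n p q)))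
    where
    g = ℕ.gcd p q
    g∣rr : g ℕ.∣ r ℕ.* r
    g∣rr = ℕ.∣m+n∣m⇒∣n {g} {p ℕ.* p} (subst (g ℕ.∣_) (trans (sym leg) (ℕ.+-comm (r ℕ.* r) _))
      (ℕ.∣m⇒∣m*n q (ℕ.gcd[m,n]∣n p q))) (ℕ.∣m⇒∣m*n p (ℕ.gcd[m,n]∣m p q))
    g⊥r : ℕ.Coprime g r
    g⊥r {d} (d∣g , d∣r) = ℕ.∣1⇒≡1 (subst (d ℕ.∣_) coprime (ℕ.gcd-greatest
      (ℕ.gcd-greatest d∣r (ℕ.∣-trans d∣g (ℕ.gcd[m,n]∣m p q))) (ℕ.∣-trans d∣g (ℕ.gcd[m,n]∣n p q))))
    g∣r : g ℕ.∣ r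
    g∣r = ℕ.coprime-divisor g⊥r g∣rr

  even-leg⇒odd : ∀ {p q r} → Leg p q r → ℕ.gcd p q ≡ 1 → 2 ℕ.∣ r → ¬ (2 ℕ.∣ p)
  even-leg⇒odd {p} {q} {r} leg coprime 2∣r 2∣p with euclidsLemma q q prime[2]
      (subst (2 ℕ.∣_) leg (ℕ.∣m∣n⇒∣m+n (ℕ.∣m⇒∣m*n r 2∣r) (ℕ.∣m⇒∣m*n p 2∣p)))
  ... | inj₁ 2∣q with ℕ.∣1⇒≡1 (subst (2 ℕ.∣_) coprime (ℕ.gcd-greatest 2∣p 2∣q))
  ...   | ()
  even-leg⇒odd leg coprime 2∣r 2∣p | inj₂ 2∣q with ℕ.∣1⇒≡1 (subst (2 ℕ.∣_) coprime (ℕ.gcd-greatest 2∣p 2∣q))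
  ...   | ()

  leg⇒< : ∀ {p q r} → 0 ℕ.< r → Leg p q r → p ℕ.< q
  leg⇒< {p} {q} {r} 0<r leg = ℕ-square-cancel-< (subst (p ℕ.* p ℕ.<_) leg
    (ℕ.+-monoˡ-< (p ℕ.* p) (ℕ.*-mono-< 0<r 0<r)))

  ℕ-leg : ∀ {p q r} → + r * + r + + p * + p ≡ + q * + q → Leg p q r
  ℕ-leg {p} {q} {r} eq = ℤ.+-injective
    (trans (cong₂ _+_ (ℤ.pos-* r r) (ℤ.pos-* p p)) (trans eq (sym (ℤ.pos-* q q))))

  leg⇒𝒮 : ∀ {p q r} → 0 ℕ.< r → Leg p q r → ℕ.gcd p q ≡ 1 → + 2 * + r < + q → 𝒮 p q
  leg⇒𝒮 {p} {q} {r} 0<r leg coprime 2r<q = inj₁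
    ( proj₂ (cos<½⇔√3/2<sin {p} {q} {r} leg) (ℤ.drop‿+<+ (subst (_< + q) (sym (ℤ.pos-* 2 r)) 2r<q))
    , leg⇒< {p} {q} {r} 0<r leg , coprime , r , leg)

  arrange-even : ∀ p q r d → 2 ℕ.∣ p → arrange p q r d ≡ + r ∷ + p ∷ + q ∷ []
  arrange-even p q r (yes _) 2∣p = refl
  arrange-even p q r (no 2∤p) 2∣p = ⊥-elim (2∤p 2∣p)

  arrange-odd : ∀ p q r d → ¬ (2 ℕ.∣ p) → arrange p q r d ≡ + p ∷ + r ∷ + q ∷ []
  arrange-odd p q r (yes 2∣p) 2∤p = ⊥-elim (2∤p 2∣p)
  arrange-odd p q r (no _) 2∤p = refl

ψ-triple-surjective : ∀ t → 𝒫 t → ∃[ c ] ψ-triple c ≡ t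
ψ-triple-surjective t (inj₂ refl) = C₁₁ , refl
ψ-triple-surjective (x ∷ y ∷ z ∷ []) (inj₁ (t∈𝔓@(+<+ {n = X} 0<x , +<+ {n = Y} 0<y , +<+ {n = Z} 0<z , 2∣y , gcd≡1 , pyth) , m))
  with minBelowHalf⇒short (x ∷ y ∷ z ∷ []) m
-- The leg below z / 2 plays √(q² - p²), so `p` is the other one; its parity then selects the
-- matching clause of `arrange`.
... | α , 2x<z = C Y Z s , arrange-even Y Z X (2 ℕ.∣? Y) 2∣y
  where
  leg : Leg Y Z X
  leg = ℕ-leg {Y} {Z} {X} pyth
  s : 𝒮 Y Z
  s = leg⇒𝒮 {r = X} 0<x leg (coprime-hypotenuse {Y} {Z} {X} leg (ℤ.+-injective gcd≡1)) 2x<z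
... | γ , 2y<z = C X Z s , arrange-odd X Z Y (2 ℕ.∣? X) (even-leg⇒odd {X} {Z} {Y} leg coprime 2∣y)
  where
  leg : Leg X Z Y
  leg = ℕ-leg {X} {Z} {Y} (trans (ℤ.+-comm (+ Y * + Y) (+ X * + X)) pyth)
  coprime : ℕ.gcd X Z ≡ 1
  coprime = coprime-hypotenuse {X} {Z} {Y} leg (trans (cong (λ g → ℕ.gcd g Z) (ℕ.gcd-comm Y X)) (ℤ.+-injective gcd≡1))
  s : 𝒮 X Z
  s = leg⇒𝒮 {r = Y} 0<y leg coprime 2y<z

ψ : Bijection 𝒞₂-setoid 𝒫-setoid
ψ = record
  { to        = to
  ; cong      = λ {c} {d} → to-cong {c} {d}
  ; bijective = (λ {c} {d} → to-injective {c} {d}) , to-surjective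
  }
  where
  to : 𝒞₂ → ∃ 𝒫
  to c = ψ-triple c , arrange∈𝒫 p/q∈𝒮 (proj₂ (𝒮-leg p/q∈𝒮)) (2 ℕ.∣? p)
    where open 𝒞₂ c
  to-cong : ∀ {c d} → 𝒞₂.members c ≐ 𝒞₂.members d → ψ-triple c ≡ ψ-triple d
  to-cong {c} {d} c≐d = ψ-triple-cong c d (proj₁ (members-≐⇒ c d c≐d)) (proj₂ (members-≐⇒ c d c≐d))
  to-injective : ∀ {c d} → ψ-triple c ≡ ψ-triple d → 𝒞₂.members c ≐ 𝒞₂.members d
  to-injective {c} {d} eq = members-≐⇐ c d (proj₁ unique) (proj₂ unique)
    where
    unique = arrange-unique (𝒞₂.p/q∈𝒮 c) (proj₂ (𝒮-leg (𝒞₂.p/q∈𝒮 c)))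
      (𝒞₂.p/q∈𝒮 d) (proj₂ (𝒮-leg (𝒞₂.p/q∈𝒮 d))) (2 ℕ.∣? 𝒞₂.p c) (2 ℕ.∣? 𝒞₂.p d) eq
  to-surjective : ∀ ((t , _) : ∃ 𝒫) → ∃[ c ] (∀ {d} → 𝒞₂.members d ≐ 𝒞₂.members c → ψ-triple d ≡ t)
  to-surjective (t , t∈𝒫) =
    let c , eq = ψ-triple-surjective t t∈𝒫
    in c , λ {d} d≐c → trans (to-cong {d} {c} d≐c) eq

ψ-formula : ∀ p q (s : 𝒮 p q) r → Leg p q r →
  (2 ℕ.∣ p → ψ-triple (C p q s) ≡ + r ∷ + p ∷ + q ∷ []) × (2 ℕ.∤ p → ψ-triple (C p q s) ≡ + p ∷ + r ∷ + q ∷ [])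
ψ-formula p q s r leg =
  (λ 2∣p → trans r-unique (arrange-even p q r (2 ℕ.∣? p) 2∣p)) ,
  (λ 2∤p → trans r-unique (arrange-odd p q r (2 ℕ.∣? p) 2∤p))
  where
  r-unique : ψ-triple (C p q s) ≡ arrange p q r (2 ℕ.∣? p)
  r-unique = cong (λ r → arrange p q r (2 ℕ.∣? p))
    (leg-unique {p} {q} {proj₁ (𝒮-leg s)} {r} (proj₂ (𝒮-leg s)) leg)

-- The monoid of classes

data Generator : List Block → Set where
  gen : ∀ {b bs} → IsGood b → All (¬_ ∘ IsGood) bs → Generator (b ∷ bs)

generator⇒admissible : ∀ {bs} → Generator bs → Admissible bs
generator⇒admissible (gen {bs = bs} g _) = g ∷ bs

concat-admissible : ∀ {us} → All Generator us → Admissible (concat us)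
concat-admissible [] = []
concat-admissible (g ∷ gs) = ++-admissible (generator⇒admissible g) (concat-admissible gs)

-- Leading bad blocks are left over here; in `factorise` they become the tail of the first
-- generator.
split-at-good : ∀ bs → ∃[ cs ] ∃[ us ] All (¬_ ∘ IsGood) cs × All Generator us × cs ++ concat us ≡ bs
split-at-good [] = [] , [] , [] , [] , refl
split-at-good (b ∷ bs) with isGood? b | split-at-good bs
... | yes g | cs , us , bad , gens , refl = [] , (b ∷ cs) ∷ us , [] , gen g bad ∷ gens , refl
... | no ¬g | cs , us , bad , gens , refl = b ∷ cs , us , ¬g ∷ bad , gens , refl

factorise : ∀ {bs} → Admissible bs → ∃[ us ] All Generator us × concat us ≡ bs
factorise [] = [] , [] , refl
factorise (_∷_ {b} g bs) with split-at-good bs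
... | cs , us , bad , gens , refl = (b ∷ cs) ∷ us , gen g bad ∷ gens , refl

-- What follows the bad run is empty or begins with a good block, so the place of the cut is forced.
split-unique : ∀ {bs cs us vs} → All (¬_ ∘ IsGood) bs → All (¬_ ∘ IsGood) cs →
  Admissible us → Admissible vs → bs ++ us ≡ cs ++ vs → bs ≡ cs × us ≡ vs
split-unique [] [] _ _ eq = refl , eq
split-unique [] (¬g ∷ _) (g ∷ _) _ refl = ⊥-elim (¬g g)
split-unique (¬g ∷ _) [] _ (g ∷ _) refl = ⊥-elim (¬g g)
split-unique (_ ∷ p) (_ ∷ q) u v eq with ∷-injective eq
... | refl , eq′ with split-unique p q u v eq′
...   | refl , us≡vs = refl , us≡vs

factorise-unique : ∀ {us vs} → All Generator us → All Generator vs → concat us ≡ concat vs → us ≡ vs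
factorise-unique [] [] eq = refl
factorise-unique [] (gen _ _ ∷ _) ()
factorise-unique (gen _ _ ∷ _) [] ()
factorise-unique (gen _ p ∷ us) (gen _ q ∷ vs) eq with ∷-injective eq
... | refl , eq′ with split-unique p q (concat-admissible us) (concat-admissible vs) eq′
...   | refl , eq″ with factorise-unique us vs eq″
...     | refl = refl

-- The map φ and the product of classes

word-of : ∃ 𝒫 → List Block
word-of (t , t∈𝒫) = proj₁ (𝒫⇒admissible t t∈𝒫)

word-of-admissible : ∀ t → Admissible (word-of t)
word-of-admissible (t , t∈𝒫) = proj₁ (proj₂ (𝒫⇒admissible t t∈𝒫))

triple-word-of : ∀ t → triple (word-of t) ≡ proj₁ t
triple-word-of (t , t∈𝒫) = proj₂ (proj₂ (𝒫⇒admissible t t∈𝒫))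

word-of-unique : ∀ t bs → triple bs ≡ proj₁ t → word-of t ≡ bs
word-of-unique t bs eq = triple-injective (word-of t) bs (trans (triple-word-of t) (sym eq))

φ : Bijection 𝒫-setoid H′-setoid
φ = record
  { to        = λ t → mat (word-of t) , admissible⇒H′ (word-of-admissible t)
  ; cong      = λ {s} {t} → φ-cong s t
  ; bijective = (λ {s} {t} eq → trans (sym (triple-word-of s)) (trans
                  (cong triple (mat-injective (word-of s) (word-of t) eq)) (triple-word-of t)))
              , surjective
  }
  where
  φ-cong : ∀ s t → proj₁ s ≡ proj₁ t → mat (word-of s) ≡ mat (word-of t)
  φ-cong s t eq = cong mat (word-of-unique s (word-of t) (trans (triple-word-of t) (sym eq)))
  surjective : ∀ ((M , _) : ∃ H′) → Σ[ t ∈ ∃ 𝒫 ] (∀ {s} → proj₁ s ≡ proj₁ t → mat (word-of s) ≡ M)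
  surjective (M , M∈H′) =
    let bs , adm , eq = H′⇒admissible M∈H′
    in (triple bs , admissible⇒𝒫 adm) , λ {s} s≡ → trans (cong mat (word-of-unique s bs (sym s≡))) eq

φ-formula : ∀ t → proj₁ (Bijection.to φ t) *ᵥ e ≡ proj₁ t
φ-formula t = trans (mat*ᵥe (word-of t)) (triple-word-of t)

φ-unique : ∀ t → t ∈ 𝒫 → ∃! _≡_ λ M → M ∈ H′ × M *ᵥ e ≡ t
φ-unique t t∈𝒫 = mat ws , (admissible⇒H′ (word-of-admissible (t , t∈𝒫)) , φ-formula (t , t∈𝒫)) , unique
  where
  ws = word-of (t , t∈𝒫)
  unique : ∀ {M} → M ∈ H′ × M *ᵥ e ≡ t → mat ws ≡ M
  unique (M∈H′ , Me≡t) =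
    let bs , _ , eq = H′⇒admissible M∈H′
    in trans (cong mat (word-of-unique (t , t∈𝒫) bs
         (trans (sym (mat*ᵥe bs)) (trans (cong (_*ᵥ e) eq) Me≡t)))) eq

_≈_ : 𝒞₂ → 𝒞₂ → Set
_≈_ = Setoid._≈_ 𝒞₂-setoid

word : 𝒞₂ → List Block
word c = word-of (Bijection.to ψ c)

triple-word : ∀ c → triple (word c) ≡ proj₁ (Bijection.to ψ c)
triple-word c = triple-word-of (Bijection.to ψ c)

word-cong : ∀ c d → c ≈ d → word c ≡ word d
word-cong c d c≈d = word-of-unique (Bijection.to ψ c) (word d)
  (trans (triple-word d) (sym (Bijection.cong ψ {c} {d} c≈d)))

word-injective : ∀ c d → word c ≡ word d → c ≈ d
word-injective c d eq = Bijection.injective ψ {c} {d}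
  (trans (sym (triple-word c)) (trans (cong triple eq) (triple-word d)))

-- Kept abstract: comparing classes of closed words would otherwise run the whole descent.
abstract
  class : ∀ {bs} → Admissible bs → 𝒞₂
  class {bs} adm = proj₁ (Bijection.surjective ψ (triple bs , admissible⇒𝒫 adm))

  ψ-class : ∀ {bs} (adm : Admissible bs) → proj₁ (Bijection.to ψ (class adm)) ≡ triple bs
  ψ-class {bs} adm = proj₂ (Bijection.surjective ψ (triple bs , admissible⇒𝒫 adm)) {class adm}
    (Setoid.refl 𝒞₂-setoid {class adm})

word-class : ∀ {bs} (adm : Admissible bs) → word (class adm) ≡ bs
word-class {bs} adm = word-of-unique (Bijection.to ψ (class adm)) bs (sym (ψ-class adm))

infixl 7 _∗_
-- Defined by concatenation of words, so that the monoid laws are those of lists; `∗-formula`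
-- recovers the description by matrices.
_∗_ : Op₂ 𝒞₂
c ∗ d = class (++-admissible (word-of-admissible (Bijection.to ψ c)) (word-of-admissible (Bijection.to ψ d)))

word-∗ : ∀ c d → word (c ∗ d) ≡ word c ++ word d
word-∗ c d = word-class (++-admissible (word-of-admissible (Bijection.to ψ c)) (word-of-admissible (Bijection.to ψ d)))

word-C₁₁ : word C₁₁ ≡ []
word-C₁₁ = word-of-unique (Bijection.to ψ C₁₁) [] refl

∗-formula : ∀ c d → proj₁ (Bijection.to ψ (c ∗ d)) ≡ (mat (word c) · mat (word d)) *ᵥ e
∗-formula c d = trans (sym (triple-word (c ∗ d))) (trans (cong triple (word-∗ c d))
  (trans (sym (mat*ᵥe (word c ++ word d))) (cong (_*ᵥ e) (mat-++ (word c) (word d)))))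

∗-isMonoid : IsMonoid _≈_ _∗_ C₁₁
∗-isMonoid = record
  { isSemigroup = record
    { isMagma = record
      { isEquivalence = Setoid.isEquivalence 𝒞₂-setoid
      ; ∙-cong = λ {a} {b} {c} {d} a≈b c≈d → word-injective (a ∗ c) (b ∗ d) (trans (word-∗ a c)
          (trans (cong₂ _++_ (word-cong a b a≈b) (word-cong c d c≈d)) (sym (word-∗ b d))))
      }
    ; assoc = λ a b c → word-injective (a ∗ b ∗ c) (a ∗ (b ∗ c))
        (trans (word-∗ (a ∗ b) c) (trans (cong (_++ word c) (word-∗ a b))
        (trans (++-assoc (word a) (word b) (word c))
        (sym (trans (word-∗ a (b ∗ c)) (cong (word a ++_) (word-∗ b c)))))))
    }
  ; identity =
      (λ c → word-injective (C₁₁ ∗ c) c (trans (word-∗ C₁₁ c) (cong (_++ word c) word-C₁₁))) ,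
      (λ c → word-injective (c ∗ C₁₁) c (trans (word-∗ c C₁₁)
        (trans (cong (word c ++_) word-C₁₁) (++-identityʳ (word c)))))
  }

𝓜 : Monoid _ _
𝓜 = toMonoid ∗-isMonoid

φψ-isomorphism : IsMonoidIsomorphism (Monoid.rawMonoid 𝓜) (H′-rawMonoid H′-closed)
  (Bijection.to φ ∘ Bijection.to ψ)
φψ-isomorphism = record
  { isMonoidMonomorphism = record
    { isMonoidHomomorphism = record
      { isMagmaHomomorphism = record
        { isRelHomomorphism = record { cong = λ {c} {d} c≈d → cong mat (word-cong c d c≈d) }
        ; homo = λ c d → trans (cong mat (word-∗ c d)) (mat-++ (word c) (word d))
        }
      ; ε-homo = cong mat word-C₁₁
      }
    ; injective = λ {c} {d} eq → word-injective c d (mat-injective (word c) (word d) eq)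
    }
  ; surjective = λ (M , M∈H′) →
      let bs , adm , eq = H′⇒admissible M∈H′
      in class adm , λ {d} d≈ → trans (cong mat (trans (word-cong d (class adm) d≈) (word-class adm))) eq
  }

-- Free generators and the Cayley digraph

X₀ : Pred 𝒞₂ 0ℓ
X₀ c = Generator (word c)

word-product : ∀ xs → word (product 𝓜 xs) ≡ concat (map word xs)
word-product []       = word-C₁₁
word-product (x ∷ xs) = trans (word-∗ x (product 𝓜 xs)) (cong (word x ++_) (word-product xs))

X₀-free : IsFreeGeneratingSet 𝓜 X₀
X₀-free = record
  { respects  = λ {c} {d} c≈d → subst Generator (word-cong c d c≈d)
  ; generates = λ c →
      let us , gens , eq = factorise (word-of-admissible (Bijection.to ψ c))
          xs , xs∈X₀ , eq′ = realise gens
      in xs , xs∈X₀ , word-injective (product 𝓜 xs) c (trans (word-product xs) (trans (cong concat eq′) eq))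
  ; unique    = λ {xs} {ys} xs∈X₀ ys∈X₀ eq → words≡⇒≈ xs ys
      (factorise-unique (generators xs∈X₀) (generators ys∈X₀)
        (trans (sym (word-product xs)) (trans (word-cong (product 𝓜 xs) (product 𝓜 ys) eq) (word-product ys))))
  }
  where
  realise : ∀ {us} → All Generator us → ∃[ xs ] All X₀ xs × map word xs ≡ us
  realise [] = [] , [] , refl
  realise (g ∷ gs) =
    let xs , xs∈X₀ , eq = realise gs
        adm = generator⇒admissible g
    in class adm ∷ xs , subst Generator (sym (word-class adm)) g ∷ xs∈X₀ , cong₂ _∷_ (word-class adm) eq
  generators : ∀ {xs} → All X₀ xs → All Generator (map word xs)
  generators []       = []
  generators (g ∷ gs) = g ∷ generators gs
  words≡⇒≈ : ∀ xs ys → map word xs ≡ map word ys → Pointwise _≈_ xs ys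
  words≡⇒≈ []       []       eq = []
  words≡⇒≈ (x ∷ xs) (y ∷ ys) eq with ∷-injective eq
  ... | eq₁ , eq₂ = word-injective x y eq₁ ∷ words≡⇒≈ xs ys eq₂

-- The exponent starts at 1 because the empty block, B alone, is not good.
Aⁿ⁺¹B : ℕ → List Block
Aⁿ⁺¹B n = replicate (suc n) α ∷ []

Aⁿ⁺¹B-generator : ∀ n → Generator (Aⁿ⁺¹B n)
Aⁿ⁺¹B-generator zero    = gen (α , single) []
Aⁿ⁺¹B-generator (suc n) = gen (α , double) []

g : ℕ → 𝒞₂
g n = class (generator⇒admissible (Aⁿ⁺¹B-generator n))

word-g : ∀ n → word (g n) ≡ Aⁿ⁺¹B n
word-g n = word-class (generator⇒admissible (Aⁿ⁺¹B-generator n))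

g∈X₀ : ∀ n → X₀ (g n)
g∈X₀ n = subst Generator (sym (word-g n)) (Aⁿ⁺¹B-generator n)

g-injective : ∀ {m n} → g m ≈ g n → m ≡ n
g-injective {m} {n} eq = ℕ.suc-injective (trans (sym (length-replicate (suc m))) (trans
  (cong length (proj₁ (∷-injective (trans (sym (word-g m)) (trans (word-cong (g m) (g n) eq) (word-g n))))))
  (length-replicate (suc n))))

∗-nonCommutative : ∃[ c ] ∃[ d ] ¬ ((c ∗ d) ≈ (d ∗ c))
∗-nonCommutative = g 0 , g 1 , FreeMonoid.non-commutative 𝓜 X₀-free g g∈X₀ (λ {m} {n} → g-injective {m} {n})

∗-notFinitelyGenerated : ¬ FinitelyGenerated 𝓜
∗-notFinitelyGenerated = FreeMonoid.not-finitelyGenerated 𝓜 X₀-free g g∈X₀ (λ {m} {n} → g-injective {m} {n})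

module _ {X : Pred 𝒞₂ 0ℓ} (free : IsFreeGeneratingSet 𝓜 X) where
  open FreeMonoid 𝓜
  open IsFreeGeneratingSet free

  -- Elements of the free set `X₀` are indecomposable and so belong to `X` as well, whichever free
  -- generating set it is.
  g∈X : ∀ n → X (g n)
  g∈X n = free⊆generating X₀-free (λ {c} {d} → respects {c} {d}) generates (g∈X₀ n)

  ∗-cayley : let Γ = Cayley 𝓜 X in
    Digraph.IsTreeRootedAt Γ C₁₁ × Infinite (Digraph.vertices Γ) × Digraph.Regular Γ × Digraph.InfiniteDegrees Γ
  ∗-cayley =
    cayley-tree free ,
    vertices-infinite free g g∈X (λ {m} {n} → g-injective {m} {n}) ,
    cayley-regular free ,
    cayley-infiniteDegrees free g g∈X (λ {m} {n} → g-injective {m} {n})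

theorem1p1 : let _≈_ = Setoid._≈_ 𝒞₂-setoid in
    Σ[ ψ ∈ Bijection 𝒞₂-setoid 𝒫-setoid ]
    (∀ p q (s : 𝒮 p q) r → Leg p q r →
    (2 ∣ p → proj₁ (Bijection.to ψ (C p q s)) ≡ + r ∷ + p ∷ + q ∷ []) ×
    (2 ∤ p → proj₁ (Bijection.to ψ (C p q s)) ≡ + p ∷ + r ∷ + q ∷ [])) ×
    (∀ t → t ∈ 𝒫 → ∃! _≡_ λ M → M ∈ H′ × M *ᵥ e ≡ t) ×
    (Σ[ φ ∈ Bijection 𝒫-setoid H′-setoid ]
    (∀ t → proj₁ (Bijection.to φ t) *ᵥ e ≡ proj₁ t) ×
    let φψ = Bijection.to φ ∘ Bijection.to ψ in
    H′ ⊆ G ×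
    (Σ[ closed ∈ (∀ {M N} → M ∈ H′ → N ∈ H′ → M · N ∈ H′) ]
    Σ[ _∗_ ∈ Op₂ 𝒞₂ ]
    (∀ c d → proj₁ (Bijection.to ψ (c ∗ d)) ≡ (proj₁ (φψ c) · proj₁ (φψ d)) *ᵥ e) ×
    (Σ[ isMonoid ∈ IsMonoid _≈_ _∗_ C₁₁ ]
    let 𝓜 = toMonoid isMonoid in
    IsMonoidIsomorphism (Monoid.rawMonoid 𝓜) (H′-rawMonoid closed) φψ ×
    (∀ Λ → Λ ∈ C⟨ 1 , 1 ⟩ ⇔ (Λ ∈ WR × Λ ∈ Orthogonal)) ×
    (Σ[ X ∈ Pred 𝒞₂ 0ℓ ] IsFreeGeneratingSet 𝓜 X) ×
    (∃[ c ] ∃[ d ] ¬ ((c ∗ d) ≈ (d ∗ c))) ×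
    ¬ FinitelyGenerated 𝓜 ×
    (∀ (X : Pred 𝒞₂ 0ℓ) → IsFreeGeneratingSet 𝓜 X →
    let Γ = Cayley 𝓜 X in
    Digraph.IsTreeRootedAt Γ C₁₁ × Infinite (Digraph.vertices Γ) ×
    Digraph.Regular Γ × Digraph.InfiniteDegrees Γ))))
theorem1p1 =
  ψ , ψ-formula , φ-unique ,
  (φ , φ-formula , H′⊆G , (H′-closed , _∗_ , ∗-formula , (∗-isMonoid , φψ-isomorphism , C₁₁⇔orthogonal ,
    (X₀ , X₀-free) , ∗-nonCommutative , ∗-notFinitelyGenerated , λ X free → ∗-cayley free)))
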